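{- Let $s \ge 5$ be a fixed integer with $s \not\equiv 0 \pmod 3$. Then there are positive constants $a$ and $b$ (depending only on $s$) such that for all sufficiently large integers $t$, $$2^{at} < r(C_s^3, K_t^3) < 2^{b t^2 \log t}.$$
   Context: A $3$-graph (triple system) $H$ with vertex set $V(H)$ is a collection of $3$-element subsets of $V(H)$, called edges. $K_n^3$ is the complete $3$-graph on $n$ vertices (all $3$-subsets are edges). For $s \ge 4$, the tight cycle $C_s^3$ is the $3$-graph with vertex set $\mathbb{Z}_s$ (integers modulo $s$) and edge set $\{\{i,i+1,i+2\} : i \in \mathbb{Z}_s\}$. For $3$-graphs $F, G$, the Ramsey number $r(F,G)$ is the minimum $n$ such that every coloring of the edges of $K_n^3$ with colors red and blue contains a copy of $F$ (as a not necessarily induced subhypergraph) all of whose edges are red, or a copy of $G$ all of whose edges are blue. -}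

module Defs where

open import Data.Nat.Base using (ℕ; zero; suc; _+_; _*_; _^_; _≤_; _<_; s≤s; z≤n; NonZero; >-nonZero)
open import Data.Nat.Properties using (≤-trans; +-assoc; +-cancelˡ-≡)
open import Data.Nat.DivMod using (_%_; _mod_; _/_; m≡m%n+[m/n]*n; m%n<n; m%n%n≡m%n)
open import Data.Nat.Divisibility using (_∣_; ∣m+n∣m⇒∣n; n∣m*n; >⇒∤)
open import Data.Integer.Base using (+_; -[1+_])
open import Data.Rational.Unnormalised.Base using (ℚᵘ; mkℚᵘ)
open import Data.Fin.Base using (Fin; zero; suc; toℕ)
open import Data.Fin.Properties using (any?; toℕ-fromℕ<) renaming (_≟_ to _≟ᶠ_)
open import Data.Fin.Subset using (Subset; inside; outside; ∣_∣; _∪_; ⁅_⁆; _∉_)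
open import Data.Fin.Subset.Properties using (_∈?_; ∪-identityˡ; ∣⁅x⁆∣≡1; x∈p∪q⁻; x∈⁅y⁆⇒x≡y)
open import Data.Vec.Base using (_∷_; tabulate; here; there)
open import Data.Product.Base using (Σ; ∃; _×_; _,_; proj₁)
open import Data.Sum.Base using (_⊎_; [_,_]′)
open import Function.Base using (id; _∘_)
open import Function.Definitions using (Injective)
open import Relation.Nullary.Decidable using (does; _×-dec_)
open import Relation.Binary.PropositionalEquality

------------------------------------------------------------------------
-- 3-graphs

record ThreeGraph : Set₁ where
  field
    order  : ℕ
    IsEdge : Subset order → Set
    size   : ∀ {e} → IsEdge e → ∣ e ∣ ≡ 3

open ThreeGraph public

Complete : ℕ → ThreeGraph
Complete n = record { order = n ; IsEdge = λ e → ∣ e ∣ ≡ 3 ; size = id }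

image : ∀ {m n} → (Fin m → Fin n) → Subset m → Subset n
image f p = tabulate λ y → does (any? λ x → (x ∈? p) ×-dec (f x ≟ᶠ y))

-- H contains a (not necessarily induced) copy of F.
Contains : ThreeGraph → ThreeGraph → Set
Contains H F = Σ (Fin (order F) → Fin (order H)) λ f →
  Injective _≡_ _≡_ f × (∀ e → IsEdge F e → IsEdge H (image f e))

------------------------------------------------------------------------
-- Tight cycles

-- The set {i, i+1, i+2} of residues modulo s.
consecutive : ∀ s .{{_ : NonZero s}} → Fin s → Subset s
consecutive s i = ⁅ i ⁆ ∪ (⁅ (toℕ i + 1) mod s ⁆ ∪ ⁅ (toℕ i + 2) mod s ⁆)

private
  ∣⁅x⁆∪p∣ : ∀ {n} (x : Fin n) (p : Subset n) → x ∉ p → ∣ ⁅ x ⁆ ∪ p ∣ ≡ suc ∣ p ∣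
  ∣⁅x⁆∪p∣ zero    (inside  ∷ p) x∉p with () ← x∉p here
  ∣⁅x⁆∪p∣ zero    (outside ∷ p) x∉p = cong (suc ∘ ∣_∣) (∪-identityˡ p)
  ∣⁅x⁆∪p∣ (suc x) (inside  ∷ p) x∉p = cong suc (∣⁅x⁆∪p∣ x p (x∉p ∘ there))
  ∣⁅x⁆∪p∣ (suc x) (outside ∷ p) x∉p = ∣⁅x⁆∪p∣ x p (x∉p ∘ there)

  shift-≢ : ∀ s .{{_ : NonZero s}} m d .{{_ : NonZero d}} → d < s → m % s ≢ (m + d) % s
  shift-≢ s m d d<s eq = >⇒∤ d<s (∣m+n∣m⇒∣n s∣ (n∣m*n (m / s)))
    where
    open ≡-Reasoning
    same : (m / s) * s + d ≡ ((m + d) / s) * s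
    same = +-cancelˡ-≡ (m % s) _ _ (begin
      m % s + ((m / s) * s + d)           ≡⟨ +-assoc (m % s) _ d ⟨
      m % s + (m / s) * s + d             ≡⟨ cong (_+ d) (m≡m%n+[m/n]*n m s) ⟨
      m + d                               ≡⟨ m≡m%n+[m/n]*n (m + d) s ⟩
      (m + d) % s + ((m + d) / s) * s     ≡⟨ cong (_+ ((m + d) / s) * s) eq ⟨
      m % s + ((m + d) / s) * s           ∎)
    s∣ : s ∣ (m / s) * s + d
    s∣ = subst (s ∣_) (sym same) (n∣m*n ((m + d) / s))

  toℕ-mod : ∀ m s .{{_ : NonZero s}} → toℕ (m mod s) ≡ m % s
  toℕ-mod m s = toℕ-fromℕ< (m%n<n m s)

  size-consecutive : ∀ s .{{_ : NonZero s}} → 4 ≤ s → ∀ i → ∣ consecutive s i ∣ ≡ 3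
  size-consecutive s 4≤s i = begin
    ∣ ⁅ i ⁆ ∪ (⁅ i₁ ⁆ ∪ ⁅ i₂ ⁆) ∣   ≡⟨ ∣⁅x⁆∪p∣ i _ i∉ ⟩
    suc ∣ ⁅ i₁ ⁆ ∪ ⁅ i₂ ⁆ ∣         ≡⟨ cong suc (∣⁅x⁆∪p∣ i₁ _ (i₁≢i₂ ∘ x∈⁅y⁆⇒x≡y i₂)) ⟩
    suc (suc ∣ ⁅ i₂ ⁆ ∣)            ≡⟨ cong (λ k → suc (suc k)) (∣⁅x⁆∣≡1 i₂) ⟩
    3                               ∎
    where
    open ≡-Reasoning
    i₁ i₂ : Fin s
    i₁ = (toℕ i + 1) mod s
    i₂ = (toℕ i + 2) mod s
    2<s : 2 < s
    2<s = ≤-trans (s≤s (s≤s (s≤s z≤n))) 4≤s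
    1<s : 1 < s
    1<s = ≤-trans (s≤s (s≤s z≤n)) 4≤s
    i≢ : ∀ d .{{_ : NonZero d}} → d < s → i ≢ (toℕ i + d) mod s
    i≢ d d<s eq = shift-≢ s (toℕ i) d d<s (begin
      toℕ i % s                         ≡⟨ cong (λ j → toℕ j % s) eq ⟩
      toℕ ((toℕ i + d) mod s) % s       ≡⟨ cong (_% s) (toℕ-mod (toℕ i + d) s) ⟩
      (toℕ i + d) % s % s               ≡⟨ m%n%n≡m%n (toℕ i + d) s ⟩
      (toℕ i + d) % s                   ∎)
    i₁≢i₂ : i₁ ≢ i₂
    i₁≢i₂ eq = shift-≢ s (toℕ i + 1) 1 1<s (begin
      (toℕ i + 1) % s       ≡⟨ toℕ-mod (toℕ i + 1) s ⟨
      toℕ i₁                ≡⟨ cong toℕ eq ⟩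
      toℕ i₂                ≡⟨ toℕ-mod (toℕ i + 2) s ⟩
      (toℕ i + 2) % s       ≡⟨ cong (_% s) (+-assoc (toℕ i) 1 1) ⟨
      (toℕ i + 1 + 1) % s   ∎)
    i∉ : i ∉ ⁅ i₁ ⁆ ∪ ⁅ i₂ ⁆
    i∉ i∈ = [ i≢ 1 1<s ∘ x∈⁅y⁆⇒x≡y i₁ , i≢ 2 2<s ∘ x∈⁅y⁆⇒x≡y i₂ ]′ (x∈p∪q⁻ ⁅ i₁ ⁆ ⁅ i₂ ⁆ i∈)

TightCycle : ∀ s → 4 ≤ s → ThreeGraph
TightCycle s 4≤s = record
  { order  = s
  ; IsEdge = λ e → ∃ λ i → e ≡ consecutive s i
  ; size   = λ (i , e≡) → trans (cong ∣_∣ e≡) (size-consecutive s 4≤s i)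
  }
  where
  instance
    s≢0 : NonZero s
    s≢0 = >-nonZero (≤-trans (s≤s z≤n) 4≤s)

------------------------------------------------------------------------
-- Ramsey numbers

data Colour : Set where
  red blue : Colour

Colouring : ℕ → Set
Colouring n = (e : Subset n) → IsEdge (Complete n) e → Colour

monochromatic : ∀ {n} → Colouring n → Colour → ThreeGraph
monochromatic {n} χ c = record
  { order  = n
  ; IsEdge = λ e → Σ (IsEdge (Complete n) e) λ p → χ e p ≡ c
  ; size   = proj₁
  }

Arrows : ℕ → ThreeGraph → ThreeGraph → Set
Arrows n F G = (χ : Colouring n) →
  Contains (monochromatic χ red) F ⊎ Contains (monochromatic χ blue) G

-- n = r(F , G)
IsRamseyNumber : ThreeGraph → ThreeGraph → ℕ → Set
IsRamseyNumber F G n = Arrows n F G × (∀ m → Arrows m F G → n ≤ m)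

------------------------------------------------------------------------
-- Comparing a natural number with a rational power

-- For x ≥ 1 the real number x^(p/d) is less than n exactly when x^p < n^d,
-- and n is less than x^(p/d) exactly when n^d < x^p; for a negative exponent
-- x^p is moved to the other side. mkℚᵘ stores the denominator minus one.

infix 4 _^[_]<_ _<_^[_] _<2^[_·log₂_]

_^[_]<_ : ℕ → ℚᵘ → ℕ → Set
x ^[ mkℚᵘ (+ p)    d-1 ]< n = x ^ p < n ^ suc d-1
x ^[ mkℚᵘ -[1+ p ] d-1 ]< n = 1 < n ^ suc d-1 * x ^ suc p

_<_^[_] : ℕ → ℕ → ℚᵘ → Set
n < x ^[ mkℚᵘ (+ p)    d-1 ] = n ^ suc d-1 < x ^ p
n < x ^[ mkℚᵘ -[1+ p ] d-1 ] = n ^ suc d-1 * x ^ suc p < 1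

-- n < 2^(q · log₂ t), using 2^(q · log₂ t) = t^q for t ≥ 1.
_<2^[_·log₂_] : ℕ → ℚᵘ → ℕ → Set
n <2^[ q ·log₂ t ] = n < t ^[ q ]

{-# OPTIONS --safe #-}
module Submission where

-- Upper bound. Order vertices by the time they are chosen and call a pair κ if it forms a κ triple with
-- every vertex still to come. If d x is red for every x on a path x₁ < … < x_{s-1} whose consecutive
-- pairs are red, then d x₁ … x_{s-1} is a red tight cycle. Keep a blue chain of apexes d and, for each d,
-- levels j = 1, …, s-2, each a blue chain of end vertices of such paths of length j. A new vertex is
-- compared with the apexes and then with the levels of one apex: either it joins a blue chain or it
-- prolongs a path. By pigeonhole this shrinks the set of remaining vertices by a factor t^(s-1) + 1 at
-- most, and after about (s-2) t² vertices a path has length s-1 or a blue chain has length t.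
--
-- Lower bound. Choose c : V × V → Fin 3 at random and colour xyz red when c x y = c x z, and likewise
-- at y and z, with distinct values at the three vertices. Along a red tight cycle
-- consecutive windows force these values to have period 3, so 3 ∣ s. A set of 6m vertices contains m²
-- triples without a common pair, each red with probability at least 1/729, so a union bound leaves
-- no blue clique when the number of vertices is exponential in m.

open import Defs
open import Data.Nat.Base hiding (_*_; _/_; _%_)
open import Data.Nat.Properties
open import Data.Nat.Divisibility using (_∣_; _∤_; divides)
open import Data.Nat.Tactic.RingSolver using (solve-∀)
open import Data.Fin.Base using (Fin; zero; suc; combine; fromℕ<; toℕ; inject≤; _↑ˡ_; finToFun; funToFin)
open import Data.Fin.Properties using (all?; combine-injective; toℕ-fromℕ<; ↑ˡ-injective; toℕ-injective; toℕ<n; inject≤-injective; finToFun-funToFin; 2↔Bool) renaming (_≟_ to _≟ᶠ_)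
open import Data.List.Base using (List; []; _∷_; length; allFin)
open import Data.List.Properties using (length-tabulate; length-++; length-map)
open import Data.List.Relation.Unary.All as All using (All; []; _∷_)
import Data.List.Relation.Unary.All.Properties as Allₚ
open import Data.List.Relation.Unary.AllPairs as AllPairs using (AllPairs; []; _∷_)
open import Data.List.Relation.Unary.Unique.Propositional using (Unique)
open import Data.List.Relation.Unary.Unique.Propositional.Properties using (filter⁺; cartesianProduct⁺; allFin⁺)
open import Data.Product.Base using (Σ; ∃; ∃₂; _×_; _,_; proj₁; proj₂)
open import Data.Sum.Base as Sum using (_⊎_; inj₁; inj₂)
open import Data.Empty using (⊥-elim)
open import Function.Base using (_∘_; id)
open import Function.Definitions using (Injective)
open import Relation.Nullary using (¬_; Dec; yes; no; does)
open import Relation.Nullary.Decidable using (map′; _×-dec_; _⊎-dec_; _→-dec_; ¬?; dec-true; from-yes; decidable-stable)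
open import Relation.Binary.PropositionalEquality

-- Counting over uniformly random labellings, free of denominators.

module UniformCounting where

  open import Data.Nat.Base using (_*_)
  open import Data.Nat.ListAction using (product)
  open import Data.Vec.Functional using (Vector) renaming (_∷_ to _∷ᶠ_)
  open import Data.List.Base using (map; filter; cartesianProduct)
  open import Data.List.Relation.Unary.Any using (Any; here; there; any?)
  import Data.List.Relation.Unary.Any.Properties as Anyₚ
  import Data.List.Relation.Unary.AllPairs.Properties as AllPairsₚ
  open import Data.List.Membership.Propositional using (_∈_; find)
  open import Data.List.Membership.Propositional.Properties using (∈-filter⁺; ∈-filter⁻; ∈-cartesianProduct⁺; ∈-allFin)
  open import Algebra.Properties.Semiring.Sum +-*-semiring using (sum; sum-cong-≗; ∑-distrib-+; *-distribʳ-sum)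
  open import Data.Empty using (⊥)
  open import Relation.Unary using (Pred; Decidable; ∁)
  open import Level using (0ℓ)

  sum-const : ∀ n k → sum {n} (λ _ → k) ≡ n * k
  sum-const zero    k = refl
  sum-const (suc n) k = cong (k +_) (sum-const n k)

  sum-≤ : ∀ {n} {f g : Vector ℕ n} → (∀ i → f i ≤ g i) → sum f ≤ sum g
  sum-≤ {zero}  f≤g = z≤n
  sum-≤ {suc n} f≤g = +-mono-≤ (f≤g zero) (sum-≤ (f≤g ∘ suc))

  sum-< : ∀ n (f : Vector ℕ n) k → sum f < n * k → ∃ λ i → f i < k
  sum-< (suc n) f k Σf<nk with f zero <? k
  ... | yes f0<k = zero , f0<k
  ... | no  f0≮k with i , fi<k ← sum-< n (f ∘ suc) k (+-cancelˡ-< k _ _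
                       (≤-<-trans (+-monoˡ-≤ _ (≮⇒≥ f0≮k)) Σf<nk)) = suc i , fi<k

  sum≡0⇒ : ∀ {n} (f : Vector ℕ n) → sum f ≡ 0 → ∀ i → f i ≡ 0
  sum≡0⇒ f Σf≡0 zero    = m+n≡0⇒m≡0 (f zero) Σf≡0
  sum≡0⇒ f Σf≡0 (suc i) = sum≡0⇒ (f ∘ suc) (m+n≡0⇒n≡0 (f zero) Σf≡0) i

  module Uniform (q : ℕ) .{{_ : NonZero q}} (o : Fin q) where

    -- This is q^N times the mean of `F` at a uniform random point. Statements about probabilities
    -- below are equations between such totals with denominators cleared.
    total : ∀ N → (Vector (Fin q) N → ℕ) → ℕ
    total zero    F = F λ ()
    total (suc N) F = sum λ j → total N λ c → F (j ∷ᶠ c)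

    total-cong : ∀ N {F G : Vector (Fin q) N → ℕ} → (∀ c → F c ≡ G c) → total N F ≡ total N G
    total-cong zero    F≡G = F≡G _
    total-cong (suc N) F≡G = sum-cong-≗ λ j → total-cong N λ c → F≡G (j ∷ᶠ c)

    total-const : ∀ N k → total N (λ _ → k) ≡ q ^ N * k
    total-const zero    k = sym (*-identityˡ k)
    total-const (suc N) k = begin
      sum {q} (λ _ → total N (λ _ → k))   ≡⟨ sum-const q _ ⟩
      q * total N (λ _ → k)               ≡⟨ cong (q *_) (total-const N k) ⟩
      q * (q ^ N * k)                     ≡⟨ *-assoc q _ k ⟨
      q ^ suc N * k                       ∎
      where open ≡-Reasoning

    total-+ : ∀ N (F G : Vector (Fin q) N → ℕ) →
              total N (λ c → F c + G c) ≡ total N F + total N G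
    total-+ zero    F G = refl
    total-+ (suc N) F G = trans (sum-cong-≗ λ j → total-+ N (F ∘ (j ∷ᶠ_)) (G ∘ (j ∷ᶠ_)))
                                (∑-distrib-+ (λ j → total N (F ∘ (j ∷ᶠ_))) λ j → total N (G ∘ (j ∷ᶠ_)))

    total-sum : ∀ N {n} (F : Fin n → Vector (Fin q) N → ℕ) →
                total N (λ c → sum λ i → F i c) ≡ sum λ i → total N (F i)
    total-sum N {zero}  F = trans (total-const N 0) (*-zeroʳ (q ^ N))
    total-sum N {suc n} F = trans (total-+ N (F zero) _) (cong (total N (F zero) +_) (total-sum N (F ∘ suc)))

    -- The first-moment argument: the mean is below 1. Fixing one coordinate at a time so that the
    -- conditional mean stays below 1 ends at a point where the natural number `F c` is itself below
    -- 1.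
    total-< : ∀ N (F : Vector (Fin q) N → ℕ) → total N F < q ^ N → ∃ λ c → F c ≡ 0
    total-< zero    F F<1 = _ , n<1⇒n≡0 F<1
    total-< (suc N) F F<  with j , Fj< ← sum-< q _ (q ^ N) F<
                          with c , Fc ← total-< N (F ∘ (j ∷ᶠ_)) Fj< = j ∷ᶠ c , Fc

    DependsOn : ∀ {N} → Pred (Fin N) 0ℓ → (Vector (Fin q) N → ℕ) → Set
    DependsOn D F = ∀ {c c′} → (∀ i → D i → c i ≡ c′ i) → F c ≡ F c′

    dependsOn-∷ : ∀ {N D} {F : Vector (Fin q) (suc N) → ℕ} j → DependsOn D F →
                  DependsOn (D ∘ suc) (F ∘ (j ∷ᶠ_))
    dependsOn-∷ j dep same = dep λ { zero _ → refl ; (suc i) → same i }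

    -- The case where the first coordinate can influence `F` only. As `G` ignores it, the coordinate
    -- is frozen at `o` inside `G`, and the smaller instances `ih` are summed over `j`.
    total-split : ∀ N (F G : Vector (Fin q) (suc N) → ℕ) →
      (∀ j → total N (λ c → F (j ∷ᶠ c) * G (o ∷ᶠ c)) * q ^ N
             ≡ total N (F ∘ (j ∷ᶠ_)) * total N (G ∘ (o ∷ᶠ_))) →
      (∀ j c → G (j ∷ᶠ c) ≡ G (o ∷ᶠ c)) →
      total (suc N) (λ c → F c * G c) * q ^ suc N ≡ total (suc N) F * total (suc N) G
    total-split N F G ih G-const = begin
      sum (λ j → total N (λ c → F (j ∷ᶠ c) * G (j ∷ᶠ c))) * (q * q ^ N)
        ≡⟨ cong (_* (q * q ^ N)) (sum-cong-≗ λ j → total-cong N λ c → cong (F (j ∷ᶠ c) *_) (G-const j c)) ⟩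
      sum (λ j → total N (λ c → F (j ∷ᶠ c) * G (o ∷ᶠ c))) * (q * q ^ N)
        ≡⟨ x*yz≡y*xz (sum λ j → total N λ c → F (j ∷ᶠ c) * G (o ∷ᶠ c)) q (q ^ N) ⟩
      q * (sum (λ j → total N (λ c → F (j ∷ᶠ c) * G (o ∷ᶠ c))) * q ^ N)
        ≡⟨ cong (q *_) (trans (*-distribʳ-sum (q ^ N) λ j → total N λ c → F (j ∷ᶠ c) * G (o ∷ᶠ c)) (sum-cong-≗ ih)) ⟩
      q * sum (λ j → total N (F ∘ (j ∷ᶠ_)) * G₀)
        ≡⟨ cong (q *_) (*-distribʳ-sum G₀ λ j → total N (F ∘ (j ∷ᶠ_))) ⟨
      q * (total (suc N) F * G₀)
        ≡⟨ x*yz≡y*xz q (total (suc N) F) G₀ ⟩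
      total (suc N) F * (q * G₀)
        ≡⟨ cong (total (suc N) F *_) (sum-const q G₀) ⟨
      total (suc N) F * sum {q} (λ _ → G₀)
        ≡⟨ cong (total (suc N) F *_) (sum-cong-≗ λ j → total-cong N (G-const j)) ⟨
      total (suc N) F * total (suc N) G
        ∎
      where
      open ≡-Reasoning
      G₀ = total N (G ∘ (o ∷ᶠ_))
      x*yz≡y*xz : ∀ x y z → x * (y * z) ≡ y * (x * z)
      x*yz≡y*xz = solve-∀

    -- This is E[FG] = E[F] E[G] multiplied by q^(2N). Induction peels off coordinates; `D?` tells
    -- which function may see the first one, and in the negative case the two functions swap places.
    independent : ∀ N {D} {F G : Vector (Fin q) N → ℕ} → Decidable D →
                  DependsOn D F → DependsOn (∁ D) G →
                  total N (λ c → F c * G c) * q ^ N ≡ total N F * total N G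
    independent zero    D? F-dep G-dep = *-identityʳ _
    independent (suc N) {D} {F} {G} D? F-dep G-dep with D? zero
    ... | yes d0 = total-split N F G
      (λ j → independent N (D? ∘ suc) (dependsOn-∷ j F-dep) (dependsOn-∷ o G-dep))
      (λ j c → G-dep λ { zero ¬d → ⊥-elim (¬d d0) ; (suc i) _ → refl })
    ... | no ¬d0 = begin
      total (suc N) (λ c → F c * G c) * q ^ suc N
        ≡⟨ cong (_* q ^ suc N) (total-cong (suc N) λ c → *-comm (F c) (G c)) ⟩
      total (suc N) (λ c → G c * F c) * q ^ suc N
        ≡⟨ total-split N G F (λ j → trans
             (cong (_* q ^ N) (total-cong N λ c → *-comm (G (j ∷ᶠ c)) (F (o ∷ᶠ c))))
             (trans (independent N (D? ∘ suc) (dependsOn-∷ o F-dep) (dependsOn-∷ j G-dep))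
                    (*-comm (total N (F ∘ (o ∷ᶠ_))) _)))
           (λ j c → F-dep λ { zero d → ⊥-elim (¬d0 d) ; (suc i) _ → refl }) ⟩
      total (suc N) G * total (suc N) F
        ≡⟨ *-comm (total (suc N) G) _ ⟩
      total (suc N) F * total (suc N) G ∎
      where open ≡-Reasoning

    module _ {A : Set} {N : ℕ} (F : A → Vector (Fin q) N → ℕ) (D : A → Pred (Fin N) 0ℓ)
             (D? : ∀ a → Decidable (D a)) (F-dep : ∀ a → DependsOn (D a) (F a)) where

      Disjoint : A → A → Set
      Disjoint a b = ∀ i → D a i → D b i → ⊥

      ∏ : List A → Vector (Fin q) N → ℕ
      ∏ as c = product (map (λ a → F a c) as)

      ∏-dependsOn : ∀ as {D′ : Pred (Fin N) 0ℓ} → All (λ a → ∀ i → D a i → D′ i) as → DependsOn D′ (∏ as)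
      ∏-dependsOn []        []           same = refl
      ∏-dependsOn (a ∷ as) (D⊆ ∷ D⊆s) same =
        cong₂ _*_ (F-dep a λ i → same i ∘ D⊆ i) (∏-dependsOn as D⊆s same)

      -- Each factor has mean y/x and different factors read disjoint coordinates, so by
      -- independence the product has mean (y/x)^(length as).
      total-∏ : ∀ {x y as} → AllPairs Disjoint as → (∀ a → total N (F a) * x ≡ y * q ^ N) →
                total N (∏ as) * x ^ length as ≡ y ^ length as * q ^ N
      total-∏ {x} {y} {[]} [] Pr = trans (*-identityʳ _) (trans (total-const N 1) (*-comm (q ^ N) 1))
      total-∏ {x} {y} {a ∷ as} (dis ∷ diss) Pr = *-cancelʳ-≡ _ _ (q ^ N) {{m^n≢0 q N}} (begin
        total N (∏ (a ∷ as)) * (x * X) * q ^ N       ≡⟨ r₁ (total N (∏ (a ∷ as))) x X (q ^ N) ⟩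
        total N (∏ (a ∷ as)) * q ^ N * (x * X)
          ≡⟨ cong (_* (x * X)) (independent N (D? a) (F-dep a)
               (∏-dependsOn as (All.map (λ d i db da → d i da db) dis))) ⟩
        total N (F a) * total N (∏ as) * (x * X)       ≡⟨ [m*n]*[o*p]≡[m*o]*[n*p] (total N (F a)) _ x X ⟩
        total N (F a) * x * (total N (∏ as) * X)       ≡⟨ cong₂ _*_ (Pr a) (total-∏ diss Pr) ⟩
        y * q ^ N * (Y * q ^ N)                        ≡⟨ r₂ y (q ^ N) Y ⟩
        y * Y * q ^ N * q ^ N                          ∎)
        where
        open ≡-Reasoning
        X = x ^ length as
        Y = y ^ length as
        r₁ : ∀ a b c d → a * (b * c) * d ≡ a * d * (b * c)
        r₁ = solve-∀
        r₂ : ∀ a b c → a * b * (c * b) ≡ a * c * b * b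
        r₂ = solve-∀

    Constraint : ℕ → Set
    Constraint N = Fin N × Fin q

    indicator : ∀ {P : Set} → Dec P → ℕ
    indicator (yes _) = 1
    indicator (no  _) = 0

    indicator≢0 : ∀ {P : Set} (P? : Dec P) → indicator P? ≢ 0 → P
    indicator≢0 (yes p) _  = p
    indicator≢0 (no  _) ≢0 = ⊥-elim (≢0 refl)

    indicator≤1 : ∀ {P : Set} (P? : Dec P) → indicator P? ≤ 1
    indicator≤1 (yes p) = ≤-refl
    indicator≤1 (no  _) = z≤n

    meets : ∀ {N} → Constraint N → Vector (Fin q) N → ℕ
    meets (i , a) c = indicator (c i ≟ᶠ a)

    sum-indicator : ∀ {n} (a : Fin n) k → sum (λ j → indicator (j ≟ᶠ a) * k) ≡ k
    sum-indicator {suc n} zero    k = trans (cong₂ _+_ (*-identityˡ k) (trans (sum-const n 0) (*-zeroʳ n))) (+-identityʳ k)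
    sum-indicator {suc n} (suc a) k = trans (sum-cong-≗ λ j → cong (_* k) (lemma j)) (sum-indicator a k)
      where
      lemma : ∀ j → indicator (suc j ≟ᶠ suc a) ≡ indicator (j ≟ᶠ a)
      lemma j with j ≟ᶠ a
      ... | yes _ = refl
      ... | no  _ = refl

    total-meets : ∀ N (i : Fin N) a → total N (meets (i , a)) * q ≡ 1 * q ^ N
    total-meets (suc N) zero a = begin
      sum (λ j → total N (λ _ → indicator (j ≟ᶠ a))) * q
        ≡⟨ cong (_* q) (sum-cong-≗ λ j → trans (total-const N (indicator (j ≟ᶠ a))) (*-comm (q ^ N) (indicator (j ≟ᶠ a)))) ⟩
      sum (λ j → indicator (j ≟ᶠ a) * q ^ N) * q          ≡⟨ cong (_* q) (sum-indicator a (q ^ N)) ⟩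
      q ^ N * q                                           ≡⟨ *-comm (q ^ N) q ⟩
      q ^ suc N                                           ≡⟨ *-identityˡ _ ⟨
      1 * q ^ suc N                                       ∎
      where open ≡-Reasoning
    total-meets (suc N) (suc i) a = begin
      sum {q} (λ j → total N (meets (i , a))) * q   ≡⟨ cong (_* q) (sum-const q _) ⟩
      q * total N (meets (i , a)) * q               ≡⟨ *-assoc q _ q ⟩
      q * (total N (meets (i , a)) * q)             ≡⟨ cong (q *_) (total-meets N i a) ⟩
      q * (1 * q ^ N)                               ≡⟨ cong (q *_) (*-identityˡ (q ^ N)) ⟩
      q ^ suc N                                     ≡⟨ *-identityˡ _ ⟨
      1 * q ^ suc N                                 ∎
      where open ≡-Reasoning

    hits : ∀ {N} → List (Constraint N) → Vector (Fin q) N → ℕ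
    hits L c = product (map (λ κ → meets κ c) L)

    total-hits : ∀ {N} {L : List (Constraint N)} → AllPairs (λ κ κ′ → proj₁ κ ≢ proj₁ κ′) L →
                 total N (hits L) * q ^ length L ≡ q ^ N
    total-hits {N} {L} distinct = trans
      (total-∏ meets (λ κ i → proj₁ κ ≡ i) (λ κ i → proj₁ κ ≟ᶠ i)
        (λ (i , a) same → cong (λ x → indicator (x ≟ᶠ a)) (same i refl))
        (AllPairs.map (λ ≢ i p q → ≢ (trans p (sym q))) distinct)
        (λ (i , a) → total-meets N i a))
      (trans (cong (_* q ^ N) (^-zeroˡ (length L))) (*-identityˡ _))

    hits≤1 : ∀ {N} (L : List (Constraint N)) c → hits L c ≤ 1
    hits≤1 []              c = ≤-refl
    hits≤1 ((i , a) ∷ L) c = *-mono-≤ (indicator≤1 (c i ≟ᶠ a)) (hits≤1 L c)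

    hits≢0 : ∀ {N} (L : List (Constraint N)) c → hits L c ≢ 0 → All (λ (i , a) → c i ≡ a) L
    hits≢0 []             c ≢0 = []
    hits≢0 ((i , a) ∷ L) c ≢0 =
      indicator≢0 (c i ≟ᶠ a) (λ eq → ≢0 (cong (_* hits L c) eq)) ∷
      hits≢0 L c (λ eq → ≢0 (trans (cong (indicator (c i ≟ᶠ a) *_) eq) (*-zeroʳ (indicator (c i ≟ᶠ a)))))

    miss : ∀ {N} → List (Constraint N) → Vector (Fin q) N → ℕ
    miss L c = 1 ∸ hits L c

    -- All constraints hold together with probability 1/(k + 1). The truncated subtraction in `miss`
    -- is exact because `hits` is at most 1, so adding `hits` back turns the claim into a count of
    -- all labellings.
    total-miss : ∀ {N} {L : List (Constraint N)} {k} → AllPairs (λ κ κ′ → proj₁ κ ≢ proj₁ κ′) L →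
                 q ^ length L ≡ suc k → total N (miss L) * suc k ≡ k * q ^ N
    total-miss {N} {L} {k} distinct q^≡ = +-cancelʳ-≡ (q ^ N) _ _ (begin
      total N (miss L) * suc k + q ^ N
        ≡⟨ cong (total N (miss L) * suc k +_) (trans (cong (total N (hits L) *_) (sym q^≡)) (total-hits distinct)) ⟨
      total N (miss L) * suc k + total N (hits L) * suc k
        ≡⟨ *-distribʳ-+ (suc k) (total N (miss L)) _ ⟨
      (total N (miss L) + total N (hits L)) * suc k
        ≡⟨ cong (_* suc k) (total-+ N (miss L) (hits L)) ⟨
      total N (λ c → miss L c + hits L c) * suc k
        ≡⟨ cong (_* suc k) (total-cong N λ c → m∸n+n≡m (hits≤1 L c)) ⟩
      total N (λ _ → 1) * suc k
        ≡⟨ cong (_* suc k) (trans (total-const N 1) (*-identityʳ (q ^ N))) ⟩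
      q ^ N * suc k
        ≡⟨ *-comm (q ^ N) (suc k) ⟩
      q ^ N + k * q ^ N
        ≡⟨ +-comm (q ^ N) _ ⟩
      k * q ^ N + q ^ N ∎)
      where open ≡-Reasoning

    hits-dependsOn : ∀ {N} (L : List (Constraint N)) → DependsOn (λ i → Any (λ κ → proj₁ κ ≡ i) L) (hits L)
    hits-dependsOn []             same = refl
    hits-dependsOn ((i , a) ∷ L) same =
      cong₂ _*_ (cong (λ x → indicator (x ≟ᶠ a)) (same i (here refl)))
                (hits-dependsOn L λ j → same j ∘ there)

    product≡0 : ∀ ns → product ns ≡ 0 → Any (_≡ 0) ns
    product≡0 (n ∷ ns) Π≡0 with m*n≡0⇒m≡0∨n≡0 n Π≡0
    ... | inj₁ n≡0  = here n≡0
    ... | inj₂ Π≡0′ = there (product≡0 ns Π≡0′)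

  -- A design of m² triples on 6m vertices, and the union bound.

  module _ {m : ℕ} where

    -- The m² triples (i , j , i + j) pairwise share at most one vertex.
    position : Fin 3 → Fin m × Fin m → Fin (m + m)
    position zero             (i , j) = i ↑ˡ m
    position (suc zero)       (i , j) = j ↑ˡ m
    position (suc (suc zero)) (i , j) = fromℕ< (+-mono-< (toℕ<n i) (toℕ<n j))

    sum-position : ∀ p → toℕ (position (suc (suc zero)) p) ≡ toℕ (proj₁ p) + toℕ (proj₂ p)
    sum-position (i , j) = toℕ-fromℕ< (+-mono-< (toℕ<n i) (toℕ<n j))

    sum-position-injective : ∀ {p p′} → position (suc (suc zero)) p ≡ position (suc (suc zero)) p′ →
                             toℕ (proj₁ p) + toℕ (proj₂ p) ≡ toℕ (proj₁ p′) + toℕ (proj₂ p′)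
    sum-position-injective {p} {p′} eq = trans (sym (sum-position p)) (trans (cong toℕ eq) (sum-position p′))

    -- Any two of i, j and i + j give the third by cancellation. This is what keeps the pairs used
    -- by different grid points disjoint.
    positions-determine : ∀ r r′ {p p′} → r ≢ r′ → position r p ≡ position r p′ →
                          position r′ p ≡ position r′ p′ → p ≡ p′
    positions-determine zero zero r≢r′ = ⊥-elim (r≢r′ refl)
    positions-determine (suc zero) (suc zero) r≢r′ = ⊥-elim (r≢r′ refl)
    positions-determine (suc (suc zero)) (suc (suc zero)) r≢r′ = ⊥-elim (r≢r′ refl)
    positions-determine zero (suc zero) _ eq eq′ =
      cong₂ _,_ (↑ˡ-injective m _ _ eq) (↑ˡ-injective m _ _ eq′)
    positions-determine (suc zero) zero _ eq eq′ =
      cong₂ _,_ (↑ˡ-injective m _ _ eq′) (↑ˡ-injective m _ _ eq)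
    positions-determine zero (suc (suc zero)) {i , j} {i′ , j′} _ eq eq′
      with refl ← ↑ˡ-injective m _ _ eq =
      cong (i ,_) (toℕ-injective (+-cancelˡ-≡ (toℕ i) _ _ (sum-position-injective {i , j} {i′ , j′} eq′)))
    positions-determine (suc zero) (suc (suc zero)) {i , j} {i′ , j′} _ eq eq′
      with refl ← ↑ˡ-injective m _ _ eq =
      cong (_, j) (toℕ-injective (+-cancelʳ-≡ (toℕ j) _ _ (sum-position-injective {i , j} {i′ , j′} eq′)))
    positions-determine (suc (suc zero)) zero ≢ eq eq′ =
      positions-determine zero (suc (suc zero)) (≢ ∘ sym) eq′ eq
    positions-determine (suc (suc zero)) (suc zero) ≢ eq eq′ =
      positions-determine (suc zero) (suc (suc zero)) (≢ ∘ sym) eq′ eq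

  length-cartesianProduct : ∀ {A B : Set} (xs : List A) (ys : List B) →
                            length (cartesianProduct xs ys) ≡ length xs * length ys
  length-cartesianProduct []       ys = refl
  length-cartesianProduct (x ∷ xs) ys = trans (length-++ (map (x ,_) ys))
    (cong₂ _+_ (length-map (x ,_) ys) (length-cartesianProduct xs ys))

  distinct? : (ρ : Fin 3 × Fin 3) → Dec (proj₁ ρ ≢ proj₂ ρ)
  distinct? (r , r′) = ¬? (r ≟ᶠ r′)

  roles : List (Fin 3 × Fin 3)
  roles = filter distinct? (cartesianProduct (allFin 3) (allFin 3))

  roles-unique : Unique roles
  roles-unique = filter⁺ distinct? (cartesianProduct⁺ (allFin⁺ 3) (allFin⁺ 3))

  ∈-roles⁺ : ∀ {r r′} → r ≢ r′ → (r , r′) ∈ roles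
  ∈-roles⁺ {r} {r′} r≢r′ = ∈-filter⁺ distinct? (∈-cartesianProduct⁺ (∈-allFin r) (∈-allFin r′)) r≢r′

  ∈-roles⁻ : ∀ {r r′} → (r , r′) ∈ roles → r ≢ r′
  ∈-roles⁻ ∈ = proj₂ (∈-filter⁻ distinct? {xs = cartesianProduct (allFin 3) (allFin 3)} ∈)

  -- The values are prescribed, not merely constant at each vertex and distinct between vertices.
  -- This special way of being red has probability exactly 1/729 on three distinct vertices.
  Matches : ∀ {n} → (Fin n → Fin n → Fin 3) → (Fin 3 → Fin n) → Set
  Matches c v = ∀ r r′ → r ≢ r′ → c (v r) (v r′) ≡ r

  module Design (n m : ℕ) where

    open Uniform 3 zero

    -- The index set splits into three blocks of size m + m, one for each role. Hence the three
    -- indices of a triple differ whatever i and j are.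
    vertex : (Fin (3 * (m + m)) → Fin n) → Fin m × Fin m → Fin 3 → Fin n
    vertex f p r = f (combine r (position r p))

    constraint : (Fin (3 * (m + m)) → Fin n) → Fin m × Fin m → Fin 3 × Fin 3 → Constraint (n * n)
    constraint f p (r , r′) = combine (vertex f p r) (vertex f p r′) , r

    constraints : (Fin (3 * (m + m)) → Fin n) → Fin m × Fin m → List (Constraint (n * n))
    constraints f p = map (constraint f p) roles

    grid : List (Fin m × Fin m)
    grid = cartesianProduct (allFin m) (allFin m)

    length-grid : length grid ≡ m * m
    length-grid = trans (length-cartesianProduct (allFin m) (allFin m))
                        (cong₂ _*_ (length-tabulate {n = m} id) (length-tabulate {n = m} id))

    module _ {f : Fin (3 * (m + m)) → Fin n} (f-inj : Injective _≡_ _≡_ f) where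

      vertex-injective : ∀ {p p′ r r′} → vertex f p r ≡ vertex f p′ r′ → r ≡ r′ × position r p ≡ position r′ p′
      vertex-injective eq = combine-injective _ _ _ _ (f-inj eq)

      constraint-injective : ∀ {p p′ ρ ρ′} → proj₁ (constraint f p ρ) ≡ proj₁ (constraint f p′ ρ′) →
        ρ ≡ ρ′ × position (proj₁ ρ) p ≡ position (proj₁ ρ) p′ × position (proj₂ ρ) p ≡ position (proj₂ ρ) p′
      constraint-injective {p} {p′} {r₁ , r₂} {r₁′ , r₂′} eq
        with eq₁ , eq₂ ← combine-injective (vertex f p r₁) (vertex f p r₂) (vertex f p′ r₁′) (vertex f p′ r₂′) eq
        with refl , pos₁ ← vertex-injective {p} {p′} {r₁} {r₁′} eq₁
        with refl , pos₂ ← vertex-injective {p} {p′} {r₂} {r₂′} eq₂ = refl , pos₁ , pos₂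

      constraints-distinct : ∀ p → AllPairs (λ κ κ′ → proj₁ κ ≢ proj₁ κ′) (constraints f p)
      constraints-distinct p = AllPairsₚ.map⁺ {f = constraint f p}
        (AllPairs.map (λ ρ≢ρ′ eq → ρ≢ρ′ (proj₁ (constraint-injective {p} {p} eq))) roles-unique)

      Uses : Fin m × Fin m → Pred (Fin (n * n)) 0ℓ
      Uses p i = Any (λ κ → proj₁ κ ≡ i) (constraints f p)

      -- A common coordinate is a common ordered pair of vertices. Its blocks reveal the two roles,
      -- and `positions-determine` then identifies the grid points.
      uses-disjoint : ∀ {p p′} → p ≢ p′ → ∀ i → Uses p i → Uses p′ i → ⊥
      uses-disjoint {p} {p′} p≢p′ i u u′
        with ρ , ρ∈ , eq ← find (Anyₚ.map⁻ {f = constraint f p} {xs = roles} u)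
           | ρ′ , _ , eq′ ← find (Anyₚ.map⁻ {f = constraint f p′} {xs = roles} u′)
        with refl , pos₁ , pos₂ ← constraint-injective {p} {p′} {ρ} {ρ′} (trans eq (sym eq′)) =
        p≢p′ (positions-determine _ _ (∈-roles⁻ ρ∈) pos₁ pos₂)

      missAll : Vector (Fin 3) (n * n) → ℕ
      missAll c = product (map (λ p → miss (constraints f p) c) grid)

      total-missAll : total (n * n) missAll * 729 ^ (m * m) ≡ 728 ^ (m * m) * 3 ^ (n * n)
      total-missAll = subst (λ k → total (n * n) missAll * 729 ^ k ≡ 728 ^ k * 3 ^ (n * n)) length-grid
        (total-∏ (miss ∘ constraints f) Uses (λ p i → any? (λ κ → proj₁ κ ≟ᶠ i) (constraints f p))
          (λ p same → cong (1 ∸_) (hits-dependsOn (constraints f p) same))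
          -- There are six roles and 3^6 = 729, so a single triple is missed with probability
          -- 728/729.
          {y = 728}
          (AllPairs.map uses-disjoint (cartesianProduct⁺ (allFin⁺ m) (allFin⁺ m)))
          (λ p → total-miss {k = 728} (constraints-distinct p) refl))

      missAll≡0⇒ : ∀ c → missAll c ≡ 0 → ∃ λ p → Matches (λ x y → c (combine x y)) (vertex f p)
      missAll≡0⇒ c Π≡0
        with p , _ , miss≡0 ← find (Anyₚ.map⁻ {xs = grid} (product≡0 _ Π≡0)) =
        p , λ r r′ r≢r′ → All.lookup (Allₚ.map⁻ {f = constraint f p} (hits≢0 (constraints f p) c
              (λ hits≡0 → 0≢1+n (trans (sym miss≡0) (cong (1 ∸_) hits≡0))))) (∈-roles⁺ r≢r′)

  injective? : ∀ {m n} (f : Fin m → Fin n) → Dec (Injective _≡_ _≡_ f)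
  injective? f = map′ (λ inj {x} {y} → inj x y) (λ inj x y → inj)
    (all? λ x → all? λ y → (f x ≟ᶠ f y) →-dec (x ≟ᶠ y))

  -- Union bound over all maps f, each of which misses all its triples with probability (728/729)^(m²).
  exists-labelling : ∀ n m → n ^ (3 * (m + m)) * 728 ^ (m * m) < 729 ^ (m * m) →
    ∃ λ (c : Fin n → Fin n → Fin 3) → ∀ (f : Fin (3 * (m + m)) → Fin n) → Injective _≡_ _≡_ f →
    ∃ λ (v : Fin 3 → Fin n) → (∀ r → ∃ λ i → v r ≡ f i) × Injective _≡_ _≡_ v × Matches c v
  exists-labelling n m bound = (λ x y → proj₁ good (combine x y)) , λ f f-inj →
      -- The union bound ranges over codes of maps. The decoded map agrees with `f` only pointwise,
      -- so injectivity and the membership of vertices are carried across `g≗f`.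
      let g       = finToFun {n} {t} (funToFin f)
          g≗f     = finToFun-funToFin f
          g-inj   : Injective _≡_ _≡_ g
          g-inj {x} {y} = λ eq → f-inj (trans (sym (g≗f x)) (trans eq (g≗f y)))
          p , mat = Design.missAll≡0⇒ n m g-inj (proj₁ good) (bad≡0 (funToFin f) g-inj)
      in Design.vertex n m g p , (λ r → _ , g≗f _) , (λ eq → proj₁ (Design.vertex-injective n m g-inj {p} {p} eq)) , mat
    where
    open Uniform 3 zero
    open Design n m
    t = 3 * (m + m)

    -- A map that is not injective contributes 0, so the sum may run over all n^t codes.
    bad′ : {f : Fin t → Fin n} → Dec (Injective _≡_ _≡_ f) → Vector (Fin 3) (n * n) → ℕ
    bad′ (yes inj) c = missAll inj c
    bad′ (no  _)   c = 0

    bad : Fin (n ^ t) → Vector (Fin 3) (n * n) → ℕ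
    bad φ = bad′ (injective? (finToFun φ))

    total-bad′ : ∀ {f} (inj? : Dec (Injective _≡_ _≡_ f)) →
                 total (n * n) (bad′ {f} inj?) * 729 ^ (m * m) ≤ 728 ^ (m * m) * 3 ^ (n * n)
    total-bad′ (yes inj) = ≤-reflexive (total-missAll inj)
    total-bad′ (no  _)   = ≤-trans (≤-reflexive (cong (_* 729 ^ (m * m))
      (trans (total-const (n * n) 0) (*-zeroʳ (3 ^ (n * n)))))) z≤n

    few-bad : total (n * n) (λ c → sum λ φ → bad φ c) < 3 ^ (n * n)
    few-bad = *-cancelʳ-< (729 ^ (m * m)) _ _ (begin-strict
      total (n * n) (λ c → sum λ φ → bad φ c) * 729 ^ (m * m)
        ≡⟨ cong (_* 729 ^ (m * m)) (total-sum (n * n) bad) ⟩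
      sum (λ φ → total (n * n) (bad φ)) * 729 ^ (m * m)
        ≡⟨ *-distribʳ-sum (729 ^ (m * m)) (λ φ → total (n * n) (bad φ)) ⟩
      sum (λ φ → total (n * n) (bad φ) * 729 ^ (m * m))
        ≤⟨ sum-≤ (λ φ → total-bad′ (injective? (finToFun φ))) ⟩
      sum {n ^ t} (λ φ → 728 ^ (m * m) * 3 ^ (n * n))
        ≡⟨ sum-const (n ^ t) _ ⟩
      n ^ t * (728 ^ (m * m) * 3 ^ (n * n))
        ≡⟨ *-assoc (n ^ t) _ _ ⟨
      n ^ t * 728 ^ (m * m) * 3 ^ (n * n)
        <⟨ *-monoˡ-< (3 ^ (n * n)) {{m^n≢0 3 (n * n)}} bound ⟩
      729 ^ (m * m) * 3 ^ (n * n)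
        ≡⟨ *-comm (729 ^ (m * m)) _ ⟩
      3 ^ (n * n) * 729 ^ (m * m) ∎)
      where open ≤-Reasoning

    good : ∃ λ c → sum (λ φ → bad φ c) ≡ 0
    good = total-< (n * n) _ few-bad

    bad′≡0⇒ : ∀ {f} (inj? : Dec (Injective _≡_ _≡_ f)) (inj : Injective _≡_ _≡_ f) c →
              bad′ {f} inj? c ≡ 0 → missAll inj c ≡ 0
    bad′≡0⇒ (yes _)   inj c ≡0 = ≡0
    bad′≡0⇒ (no ¬inj) inj c _  = ⊥-elim (¬inj inj)

    bad≡0 : ∀ φ (inj : Injective _≡_ _≡_ (finToFun {n} {t} φ)) → missAll inj (proj₁ good) ≡ 0
    bad≡0 φ inj = bad′≡0⇒ (injective? (finToFun φ)) inj (proj₁ good)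
      (sum≡0⇒ (λ φ → bad φ (proj₁ good)) (proj₂ good) φ)

-- The online game that builds blue chains and paths with a red apex.

module OnlineGame where

  open import Data.Nat.Base using (_*_)
  open import Data.Nat.ListAction using (sum)
  open import Data.Nat.ListAction.Properties using (sum-++)
  open import Data.List.Base using (_++_; map; replicate)
  open import Data.List.Properties using (length-replicate; map-++)
  open import Data.List.Relation.Unary.Any using (here; there)
  open import Data.List.Membership.Propositional using (_∈_)
  open import Data.List.Membership.Propositional.Properties using (∈-∃++)
  open import Data.List.Relation.Binary.Sublist.Propositional using (_⊆_; []; _∷_; _∷ʳ_; ⊆-refl; ⊆-trans; minimum)
  open import Data.List.Relation.Binary.Sublist.Propositional.Properties using (All-resp-⊆)
  open import Data.Unit.Base using (⊤; tt)

  Unique-resp-⊆ : ∀ {A : Set} {xs ys : List A} → xs ⊆ ys → Unique ys → Unique xs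
  Unique-resp-⊆ []         []       = []
  Unique-resp-⊆ (y ∷ʳ τ)   (_ ∷ u)  = Unique-resp-⊆ τ u
  Unique-resp-⊆ (refl ∷ τ) (≢s ∷ u) = All-resp-⊆ τ ≢s ∷ Unique-resp-⊆ τ u

  split : ∀ {V : Set} (f : V → Colour) (W : List V) → ∃₂ λ R B →
          (R ⊆ W × All (λ w → f w ≡ red) R) × (B ⊆ W × All (λ w → f w ≡ blue) B) ×
          length R + length B ≡ length W
  split f []      = [] , [] , ([] , []) , ([] , []) , refl
  split f (w ∷ W) with R , B , (R⊆ , reds) , (B⊆ , blues) , len ← split f W | f w in fw
  ... | red  = w ∷ R , B , (refl ∷ R⊆ , fw ∷ reds) , (w ∷ʳ B⊆ , blues) , cong suc len
  ... | blue = R , w ∷ B , (w ∷ʳ R⊆ , reds) , (refl ∷ B⊆ , fw ∷ blues) ,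
               trans (+-suc (length R) (length B)) (cong suc len)

  module Game {V : Set} (col : V → V → V → Colour) (t : ℕ) .{{_ : NonZero t}} (M : ℕ) where

    Pair : Colour → List V → V → V → Set
    Pair κ W x y = All (λ w → col x y w ≡ κ) W

    -- Vertices are listed latest first, and W holds the vertices still to come.
    Chain : List V → List V → Set
    Chain W []      = ⊤
    Chain W (y ∷ L) = All (y ≢_) W × All (λ x → Pair blue W x y) L × Chain (y ∷ W) L

    Link : List V → V → List V → Set
    Link W y []      = ⊤
    Link W y (x ∷ _) = Pair red W x y

    -- A path vertex belongs to the future of all older ones, hence `y ∷ W` in the recursion. Once
    -- `W` is empty, `d` is therefore red with every two path vertices, and every three consecutive
    -- path vertices are red.
    Path : List V → V → List V → Set
    Path W d []      = All (d ≢_) W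
    Path W d (y ∷ p) = All (y ≢_) W × Pair red W d y × Link W y p × Path (y ∷ W) d p

    Chain-mono : ∀ {W′ W} L → W′ ⊆ W → Chain W L → Chain W′ L
    Chain-mono []      τ _                = tt
    Chain-mono (y ∷ L) τ (≢s , blues , c) =
      All-resp-⊆ τ ≢s , All.map (All-resp-⊆ τ) blues , Chain-mono L (refl ∷ τ) c

    Link-mono : ∀ {W′ W y} p → W′ ⊆ W → Link W y p → Link W′ y p
    Link-mono []      τ _ = tt
    Link-mono (x ∷ _) τ   = All-resp-⊆ τ

    Path-mono : ∀ {W′ W d} p → W′ ⊆ W → Path W d p → Path W′ d p
    Path-mono []      τ = All-resp-⊆ τ
    Path-mono (y ∷ p) τ (≢s , reds , link , path) =
      All-resp-⊆ τ ≢s , All-resp-⊆ τ reds , Link-mono p τ link , Path-mono p (refl ∷ τ) path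

    Outcome : Set
    Outcome = (∃ λ L → length L ≡ t × Chain [] L) ⊎ (∃₂ λ d p → length p ≡ suc M × Path [] d p)

    -- Scan `xs`: if the red class of the current element has at least k vertices, keep it and stop;
    -- otherwise fewer than k are lost by passing to the blue class. The budget of `suc (length xs)`
    -- blocks of size k covers one loss per element and leaves k at the end.
    select : ∀ {A : Set} (h : A → V) v k (xs : List A) W → suc (length xs) * k ≤ length W →
      (∃ λ W′ → W′ ⊆ W × k ≤ length W′ × All (λ x → Pair blue W′ (h x) v) xs) ⊎
      (∃₂ λ x W′ → x ∈ xs × W′ ⊆ W × k ≤ length W′ × Pair red W′ (h x) v)
    select h v k []       W k≤ = inj₁ (W , ⊆-refl , ≤-trans (m≤m+n k 0) k≤ , [])
    select h v k (x ∷ xs) W k≤ with split (col (h x) v) W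
    ... | R , B , (R⊆ , reds) , (B⊆ , blues) , len with k ≤? length R
    ... | yes k≤R = inj₂ (x , R , here refl , R⊆ , k≤R , reds)
    ... | no  k≰R with select h v k xs B (+-cancelˡ-≤ k _ _ (begin
          k + suc (length xs) * k   ≤⟨ k≤ ⟩
          length W                  ≡⟨ len ⟨
          length R + length B       ≤⟨ +-monoˡ-≤ (length B) (≰⇒≥ k≰R) ⟩
          k + length B              ∎))
      where open ≤-Reasoning
    ... | inj₁ (W′ , τ , k≤W′ , all) = inj₁ (W′ , ⊆-trans τ B⊆ , k≤W′ , All-resp-⊆ τ blues ∷ all)
    ... | inj₂ (y , W′ , y∈ , τ , k≤W′ , reds′) = inj₂ (y , W′ , there y∈ , ⊆-trans τ B⊆ , k≤W′ , reds′)

    -- A path is stored as its last vertex together with the list of the earlier ones.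
    Level : Set
    Level = List (V × List V)

    -- The index `j` counts earlier vertices, so paths at index j have j + 1 vertices. The strict
    -- bound by t says that no level has won yet, and makes a comparison with a level cost a factor
    -- of at most t.
    ValidLevels : List V → V → ℕ → List Level → Set
    ValidLevels W d j []       = ⊤
    ValidLevels W d j (l ∷ ls) =
      Chain W (map proj₁ l) × length l < t ×
      All (λ (y , p) → length p ≡ j × Path W d (y ∷ p)) l × ValidLevels W d (suc j) ls

    ValidLevels-mono : ∀ {W′ W d j} ls → W′ ⊆ W → ValidLevels W d j ls → ValidLevels W′ d j ls
    ValidLevels-mono []       τ _ = tt
    ValidLevels-mono (l ∷ ls) τ (chain , l<t , paths , valid) =
      Chain-mono (map proj₁ l) τ chain , l<t ,
      All.map (λ { {y , p} (len , path) → len , Path-mono (y ∷ p) τ path }) paths ,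
      ValidLevels-mono ls τ valid

    levelsSize : List Level → ℕ
    levelsSize ls = sum (map length ls)

    levelsSize≤ : ∀ {W d j} ls → ValidLevels W d j ls → levelsSize ls ≤ length ls * t
    levelsSize≤ []       _                     = z≤n
    levelsSize≤ (l ∷ ls) (_ , l<t , _ , valid) = +-mono-≤ (<⇒≤ l<t) (levelsSize≤ ls valid)

    k≤t^i*k : ∀ i k → k ≤ t ^ i * k
    k≤t^i*k i k = m≤n*m k (t ^ i) {{m^n≢0 t i}}

    Inserted : V → ℕ → ℕ → List V → List Level → Set
    Inserted d j k W ls = ∃₂ λ ls′ W′ → W′ ⊆ W × k ≤ length W′ × ValidLevels W′ d j ls′ ×
      length ls′ ≡ length ls × levelsSize ls′ ≡ suc (levelsSize ls)

    -- The vertex `v` descends through the levels. If it is blue with all end vertices of a level,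
    -- it joins that level; if it is red with the end `y` of a stored path, it prolongs that path,
    -- abandoning `p`, and moves on to the next level. Past the last level its path has M + 1
    -- vertices.
    insert : ∀ {d k j v p W} ls → j + length ls ≡ M → ValidLevels (v ∷ W) d j ls → length p ≡ j →
      Path W d (v ∷ p) → t ^ length ls * k ≤ length W → Outcome ⊎ Inserted d j k W ls
    insert {d} {j = j} {v} {p} [] j≡M _ p≡j path _ =
      inj₁ (inj₂ (d , v ∷ p , cong suc (trans p≡j (trans (sym (+-identityʳ j)) j≡M)) ,
                  Path-mono (v ∷ p) (minimum _) path))
    insert {d} {k} {j} {v} {p} {W} (l ∷ ls) j≡M (chain , l<t , paths , valid) p≡j path@(v≢ , dv , _) big
      with select proj₁ v (t ^ length ls * k) l W
             (≤-trans (*-monoˡ-≤ (t ^ length ls * k) l<t) (≤-trans (≤-reflexive (sym (*-assoc t _ k))) big))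
    ... | inj₁ (W′ , τ , big′ , blues) = result (suc (length l) ≟ t)
      where
      chain′ : Chain W′ (map proj₁ ((v , p) ∷ l))
      chain′ = All-resp-⊆ τ v≢ , Allₚ.map⁺ blues , Chain-mono (map proj₁ l) (refl ∷ τ) chain
      result : _ → Outcome ⊎ Inserted d j k W (l ∷ ls)
      result (yes l+1≡t) = inj₁ (inj₁ (map proj₁ ((v , p) ∷ l) ,
        trans (cong suc (length-map proj₁ l)) l+1≡t ,
        Chain-mono (map proj₁ ((v , p) ∷ l)) (minimum _) chain′))
      result (no l+1≢t) = inj₂ (((v , p) ∷ l) ∷ ls , W′ , τ , ≤-trans (k≤t^i*k (length ls) k) big′ ,
        (chain′ , ≤∧≢⇒< l<t l+1≢t ,
         (p≡j , Path-mono (v ∷ p) τ path) ∷ proj₁ (proj₂ (proj₂ rest)) ,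
         proj₂ (proj₂ (proj₂ rest))) , refl , refl)
        where rest = ValidLevels-mono (l ∷ ls) (v ∷ʳ τ) (chain , l<t , paths , valid)
    ... | inj₂ ((y , q) , W′ , y∈l , τ , big′ , yv)
      with q≡j , path-q ← All.lookup paths y∈l
      with insert {p = y ∷ q} ls (trans (sym (+-suc j (length ls))) j≡M) (ValidLevels-mono ls (refl ∷ τ) valid) (cong suc q≡j)
             (All-resp-⊆ τ v≢ , All-resp-⊆ τ dv , yv , Path-mono (y ∷ q) (refl ∷ τ) path-q) big′
    ... | inj₁ win = inj₁ win
    ... | inj₂ (ls′ , W″ , τ′ , k≤ , valid′ , len , size≡) =
      inj₂ (l ∷ ls′ , W″ , ⊆-trans τ′ τ , k≤ ,
        (proj₁ rest , l<t , proj₁ (proj₂ (proj₂ rest)) , valid′) ,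
        cong suc len , trans (cong (length l +_) size≡) (+-suc (length l) (levelsSize ls)))
      where rest = ValidLevels-mono (l ∷ ls) (v ∷ʳ ⊆-trans τ′ τ) (chain , l<t , paths , valid)

    Group : Set
    Group = V × List Level

    ValidGroup : List V → Group → Set
    ValidGroup W (d , ls) = length ls ≡ M × ValidLevels W d 0 ls × All (d ≢_) W

    ValidGroup-mono : ∀ {W′ W g} → W′ ⊆ W → ValidGroup W g → ValidGroup W′ g
    ValidGroup-mono {g = _ , ls} τ (len , valid , d≢) = len , ValidLevels-mono ls τ valid , All-resp-⊆ τ d≢

    ValidLevels-replicate : ∀ {W d} j i → ValidLevels W d j (replicate i [])
    ValidLevels-replicate j zero    = tt
    ValidLevels-replicate j (suc i) = tt , >-nonZero⁻¹ t , [] , ValidLevels-replicate (suc j) i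

    groupSize : Group → ℕ
    groupSize (_ , ls) = suc (levelsSize ls)

    stateSize : List Group → ℕ
    stateSize gs = sum (map groupSize gs)

    -- A group is an apex with at most t vertices on each of M levels, and there are at most t
    -- groups. In `stepCost` one factor t pays for the apexes, t^M for the levels, and the added 1
    -- for the vertex being placed.
    groupCapacity capacity stepCost : ℕ
    groupCapacity = suc (M * t)
    capacity      = t * groupCapacity
    stepCost      = suc (t ^ suc M)

    stateSize≤ : ∀ {W gs} → All (ValidGroup W) gs → stateSize gs ≤ length gs * groupCapacity
    stateSize≤ []                                = z≤n
    stateSize≤ {gs = (_ , ls) ∷ _} ((len , valid , _) ∷ vs) = +-mono-≤
      (s≤s (≤-trans (levelsSize≤ ls valid) (≤-reflexive (cong (_* t) len)))) (stateSize≤ vs)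

    stateSize-middle : ∀ gs g hs → stateSize (gs ++ g ∷ hs) ≡ stateSize gs + (groupSize g + stateSize hs)
    stateSize-middle gs g hs = trans (cong sum (map-++ groupSize gs (g ∷ hs))) (sum-++ (map groupSize gs) _)

    length-middle : ∀ {A : Set} (xs : List A) {y y′ zs} → length (xs ++ y ∷ zs) ≡ length (xs ++ y′ ∷ zs)
    length-middle xs = trans (length-++ xs) (sym (length-++ xs))

    -- Each round stores one vertex, so `stateSize gs + fuel` stays constant while `W` shrinks by a
    -- factor of at most `stepCost`. Without fuel the state would exceed its capacity.
    play : ∀ fuel W gs → Unique W → Chain W (map proj₁ gs) → All (ValidGroup W) gs → length gs < t →
           capacity < stateSize gs + fuel → stepCost ^ fuel ≤ length W → Outcome
    play zero W gs _ _ groups gs<t cap< _ = ⊥-elim (<⇒≱ cap< (begin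
      stateSize gs + 0                ≡⟨ +-identityʳ (stateSize gs) ⟩
      stateSize gs                    ≤⟨ stateSize≤ groups ⟩
      length gs * groupCapacity  ≤⟨ *-monoˡ-≤ groupCapacity (<⇒≤ gs<t) ⟩
      capacity                   ∎))
      where open ≤-Reasoning
    play (suc fuel) [] gs _ _ _ _ _ big = ⊥-elim (<⇒≱ (m^n>0 stepCost (suc fuel)) big)
    play (suc fuel) (v ∷ W) gs (v≢ ∷ uniq) chain groups gs<t cap< big
      with select proj₁ v (t ^ M * stepCost ^ fuel) gs W
             (≤-trans (*-monoˡ-≤ (t ^ M * stepCost ^ fuel) gs<t)
               (≤-trans (≤-reflexive (sym (*-assoc t (t ^ M) _)))
                 -- The power stepCost^(fuel + 1) is stepCost^fuel plus t^(M + 1) times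
                 -- stepCost^fuel; the first summand is at least 1 and absorbs `v`.
                 (s≤s⁻¹ (≤-trans (+-monoˡ-≤ _ (m^n>0 stepCost fuel)) big))))
    ... | inj₁ (W′ , τ , big′ , blues) = result (suc (length gs) ≟ t)
      where
      chain′ : Chain W′ (v ∷ map proj₁ gs)
      chain′ = All-resp-⊆ τ v≢ , Allₚ.map⁺ blues , Chain-mono (map proj₁ gs) (refl ∷ τ) chain
      new : Group
      new = v , replicate M []
      size-new : groupSize new + stateSize gs + fuel ≡ stateSize gs + suc fuel
      size-new = trans (cong (λ n → suc n + stateSize gs + fuel) (empty M)) (sym (+-suc (stateSize gs) fuel))
        where
        empty : ∀ i → levelsSize (replicate i []) ≡ 0
        empty zero    = refl
        empty (suc i) = empty i
      result : _ → Outcome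
      result (yes gs+1≡t) = inj₁ (v ∷ map proj₁ gs ,
        trans (cong suc (length-map proj₁ gs)) gs+1≡t ,
        Chain-mono (v ∷ map proj₁ gs) (minimum _) chain′)
      result (no gs+1≢t) = play fuel W′ (new ∷ gs) (Unique-resp-⊆ τ uniq) chain′
        ((length-replicate M , ValidLevels-replicate 0 M , All-resp-⊆ τ v≢) ∷
         All.map (ValidGroup-mono (v ∷ʳ τ)) groups)
        (≤∧≢⇒< gs<t gs+1≢t) (subst (capacity <_) (sym size-new) cap<)
        (≤-trans (k≤t^i*k M (stepCost ^ fuel)) big′)
    ... | inj₂ ((d , ls) , W′ , d∈ , τ , big′ , dv)
      with as , bs , refl ← ∈-∃++ d∈
      with vas , (len , valid , d≢) ∷ vbs ← Allₚ.++⁻ as groups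
      -- Being red with the apex `d`, the vertex `v` starts a path of its own and enters at index 0.
      with insert {p = []} ls len (ValidLevels-mono ls (refl ∷ τ) valid) refl
             (All-resp-⊆ τ v≢ , dv , tt , All-resp-⊆ (refl ∷ τ) d≢)
             (≤-trans (≤-reflexive (cong (λ n → t ^ n * stepCost ^ fuel) len)) big′)
    ... | inj₁ win = win
    ... | inj₂ (ls′ , W″ , τ′ , k≤ , valid′ , len′ , size′) =
      play fuel W″ (as ++ (d , ls′) ∷ bs) (Unique-resp-⊆ τ″ uniq)
        (subst (Chain W″) same-heads (Chain-mono (map proj₁ (as ++ (d , ls) ∷ bs)) (v ∷ʳ τ″) chain))
        (Allₚ.++⁺ (All.map (ValidGroup-mono (v ∷ʳ τ″)) vas)
          ((trans len′ len , valid′ , All-resp-⊆ (v ∷ʳ τ″) d≢) ∷ All.map (ValidGroup-mono (v ∷ʳ τ″)) vbs))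
        (subst (_< t) (length-middle as) gs<t) (subst (capacity <_) bigger cap<) k≤
      where
      τ″ = ⊆-trans τ′ τ
      same-heads : map proj₁ (as ++ (d , ls) ∷ bs) ≡ map proj₁ (as ++ (d , ls′) ∷ bs)
      same-heads = trans (map-++ proj₁ as _) (sym (map-++ proj₁ as _))
      bigger : stateSize (as ++ (d , ls) ∷ bs) + suc fuel ≡ stateSize (as ++ (d , ls′) ∷ bs) + fuel
      bigger = begin
        stateSize (as ++ (d , ls) ∷ bs) + suc fuel
          ≡⟨ cong (_+ suc fuel) (stateSize-middle as (d , ls) bs) ⟩
        stateSize as + (suc (levelsSize ls) + stateSize bs) + suc fuel
          ≡⟨ +-suc _ fuel ⟩
        suc (stateSize as + (suc (levelsSize ls) + stateSize bs)) + fuel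
          ≡⟨ cong (_+ fuel) (+-suc (stateSize as) (suc (levelsSize ls) + stateSize bs)) ⟨
        stateSize as + (suc (suc (levelsSize ls)) + stateSize bs) + fuel
          ≡⟨ cong (λ n → stateSize as + (suc n + stateSize bs) + fuel) size′ ⟨
        stateSize as + (suc (levelsSize ls′) + stateSize bs) + fuel
          ≡⟨ cong (_+ fuel) (stateSize-middle as (d , ls′) bs) ⟨
        stateSize (as ++ (d , ls′) ∷ bs) + fuel ∎
        where open ≡-Reasoning

    win : ∀ W → Unique W → stepCost ^ suc capacity ≤ length W → Outcome
    win W uniq = play (suc capacity) W [] uniq tt [] (>-nonZero⁻¹ t) ≤-refl

-- Three-element subsets and their images.

module Triples where

  open import Data.Nat.DivMod using (_%_; m<n⇒m%n≡m; n%n≡0)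
  import Data.Fin.Base as Fin
  import Data.Fin.Properties as Finₚ
  open import Data.Fin.Properties using (any?)
  open import Data.Fin.Subset using (Subset; inside; outside; ∣_∣; _∪_; ⁅_⁆; _∈_; _∉_; ⊥)
  open import Data.Fin.Subset.Properties using (_∈?_; ∪-comm; ∪-assoc; ∪-identityˡ; ∪-identityʳ; ∪-idem; ∣⁅x⁆∣≡1; x∈p∪q⁻; x∈p∪q⁺; x∈⁅y⁆⇒x≡y; x∈⁅x⁆; ⊆-antisym)
  open import Data.Bool.Properties using () renaming (_≟_ to _≟ᵇ_)
  open import Data.Vec.Base using ([]; _∷_; here; there)
  open import Data.Vec.Properties using (lookup∘tabulate; ≡-dec; []=⇒lookup; lookup⇒[]=)
  open import Data.List.Base using (lookup)
  open import Data.List.Membership.Propositional.Properties using (∈-lookup)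
  open import Relation.Binary.Definitions using (tri<; tri≈; tri>)

  private variable
    n m : ℕ

  triple : Fin n → Fin n → Fin n → Subset n
  triple x y z = ⁅ x ⁆ ∪ (⁅ y ⁆ ∪ ⁅ z ⁆)

  triple-swap : ∀ (x y z : Fin n) → triple x y z ≡ triple y x z
  triple-swap x y z = begin
    ⁅ x ⁆ ∪ (⁅ y ⁆ ∪ ⁅ z ⁆)   ≡⟨ ∪-assoc ⁅ x ⁆ ⁅ y ⁆ ⁅ z ⁆ ⟨
    (⁅ x ⁆ ∪ ⁅ y ⁆) ∪ ⁅ z ⁆   ≡⟨ cong (_∪ ⁅ z ⁆) (∪-comm ⁅ x ⁆ ⁅ y ⁆) ⟩
    (⁅ y ⁆ ∪ ⁅ x ⁆) ∪ ⁅ z ⁆   ≡⟨ ∪-assoc ⁅ y ⁆ ⁅ x ⁆ ⁅ z ⁆ ⟩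
    ⁅ y ⁆ ∪ (⁅ x ⁆ ∪ ⁅ z ⁆)   ∎
    where open ≡-Reasoning

  triple-swapʳ : ∀ (x y z : Fin n) → triple x y z ≡ triple x z y
  triple-swapʳ x y z = cong (⁅ x ⁆ ∪_) (∪-comm ⁅ y ⁆ ⁅ z ⁆)

  triple-reverse : ∀ (x y z : Fin n) → triple x y z ≡ triple z y x
  triple-reverse x y z = trans (triple-swap x y z) (trans (triple-swapʳ y x z) (triple-swap y z x))

  ∈-triple⁻ : ∀ {w} (x y z : Fin n) → w ∈ triple x y z → w ≡ x ⊎ w ≡ y ⊎ w ≡ z
  ∈-triple⁻ x y z w∈ with x∈p∪q⁻ ⁅ x ⁆ _ w∈
  ... | inj₁ w∈x = inj₁ (x∈⁅y⁆⇒x≡y x w∈x)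
  ... | inj₂ w∈yz with x∈p∪q⁻ ⁅ y ⁆ _ w∈yz
  ... | inj₁ w∈y = inj₂ (inj₁ (x∈⁅y⁆⇒x≡y y w∈y))
  ... | inj₂ w∈z = inj₂ (inj₂ (x∈⁅y⁆⇒x≡y z w∈z))

  ∈-triple₁ : ∀ (x y z : Fin n) → x ∈ triple x y z
  ∈-triple₁ x y z = x∈p∪q⁺ (inj₁ (x∈⁅x⁆ x))

  ∈-triple₂ : ∀ (x y z : Fin n) → y ∈ triple x y z
  ∈-triple₂ x y z = x∈p∪q⁺ {p = ⁅ x ⁆} (inj₂ (x∈p∪q⁺ (inj₁ (x∈⁅x⁆ y))))

  ∈-triple₃ : ∀ (x y z : Fin n) → z ∈ triple x y z
  ∈-triple₃ x y z = x∈p∪q⁺ {p = ⁅ x ⁆} (inj₂ (x∈p∪q⁺ {p = ⁅ y ⁆} (inj₂ (x∈⁅x⁆ z))))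

  ∣⁅x⁆∪p∣≡1+∣p∣ : ∀ (x : Fin n) p → x ∉ p → ∣ ⁅ x ⁆ ∪ p ∣ ≡ suc ∣ p ∣
  ∣⁅x⁆∪p∣≡1+∣p∣ zero    (inside  ∷ p) x∉p = ⊥-elim (x∉p here)
  ∣⁅x⁆∪p∣≡1+∣p∣ zero    (outside ∷ p) x∉p = cong (suc ∘ ∣_∣) (∪-identityˡ p)
  ∣⁅x⁆∪p∣≡1+∣p∣ (suc x) (inside  ∷ p) x∉p = cong suc (∣⁅x⁆∪p∣≡1+∣p∣ x p (x∉p ∘ there))
  ∣⁅x⁆∪p∣≡1+∣p∣ (suc x) (outside ∷ p) x∉p = ∣⁅x⁆∪p∣≡1+∣p∣ x p (x∉p ∘ there)

  Distinct : Fin n → Fin n → Fin n → Set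
  Distinct x y z = x ≢ y × x ≢ z × y ≢ z

  ∣triple∣≡3 : ∀ {x y z : Fin n} → Distinct x y z → ∣ triple x y z ∣ ≡ 3
  ∣triple∣≡3 {x = x} {y} {z} (x≢y , x≢z , y≢z) = begin
    ∣ ⁅ x ⁆ ∪ (⁅ y ⁆ ∪ ⁅ z ⁆) ∣   ≡⟨ ∣⁅x⁆∪p∣≡1+∣p∣ x _ x∉ ⟩
    suc ∣ ⁅ y ⁆ ∪ ⁅ z ⁆ ∣         ≡⟨ cong suc (∣⁅x⁆∪p∣≡1+∣p∣ y _ (y≢z ∘ x∈⁅y⁆⇒x≡y z)) ⟩
    suc (suc ∣ ⁅ z ⁆ ∣)           ≡⟨ cong (2 +_) (∣⁅x⁆∣≡1 z) ⟩
    3                             ∎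
    where
    open ≡-Reasoning
    x∉ : x ∉ ⁅ y ⁆ ∪ ⁅ z ⁆
    x∉ x∈ with x∈p∪q⁻ ⁅ y ⁆ ⁅ z ⁆ x∈
    ... | inj₁ x∈y = x≢y (x∈⁅y⁆⇒x≡y y x∈y)
    ... | inj₂ x∈z = x≢z (x∈⁅y⁆⇒x≡y z x∈z)

  ∣triple-xxy∣≢3 : ∀ (x y : Fin n) → ∣ triple x x y ∣ ≢ 3
  ∣triple-xxy∣≢3 x y size = ∣pair∣≢3 (x ≟ᶠ y) (trans (cong ∣_∣ (begin
    ⁅ x ⁆ ∪ ⁅ y ⁆             ≡⟨ cong (_∪ ⁅ y ⁆) (∪-idem ⁅ x ⁆) ⟨
    (⁅ x ⁆ ∪ ⁅ x ⁆) ∪ ⁅ y ⁆   ≡⟨ ∪-assoc ⁅ x ⁆ ⁅ x ⁆ ⁅ y ⁆ ⟩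
    triple x x y              ∎)) size)
    where
    open ≡-Reasoning
    ∣pair∣≢3 : ∀ {n} {x y : Fin n} → Dec (x ≡ y) → ∣ ⁅ x ⁆ ∪ ⁅ y ⁆ ∣ ≢ 3
    ∣pair∣≢3 {x = x} (yes refl) eq
      with () ← trans (sym (trans (cong ∣_∣ (∪-idem ⁅ x ⁆)) (∣⁅x⁆∣≡1 x))) eq
    ∣pair∣≢3 {x = x} {y} (no x≢y) eq
      with () ← trans (sym (trans (∣⁅x⁆∪p∣≡1+∣p∣ x ⁅ y ⁆ (x≢y ∘ x∈⁅y⁆⇒x≡y y)) (cong suc (∣⁅x⁆∣≡1 y)))) eq

  triple-distinct : ∀ (x y z : Fin n) → ∣ triple x y z ∣ ≡ 3 → Distinct x y z
  triple-distinct x y z size =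
    (λ { refl → ∣triple-xxy∣≢3 x z size }) ,
    (λ { refl → ∣triple-xxy∣≢3 x y (trans (cong ∣_∣ (triple-swapʳ x x y)) size) }) ,
    (λ { refl → ∣triple-xxy∣≢3 y x (trans (cong ∣_∣ (trans (triple-swapʳ y y x) (triple-swap y x y))) size) })

  extract-least : ∀ {k} (e : Subset n) → ∣ e ∣ ≡ suc k →
    ∃₂ λ i e′ → e ≡ ⁅ i ⁆ ∪ e′ × ∣ e′ ∣ ≡ k × (∀ {j} → j ∈ e′ → i Fin.< j)
  extract-least (inside ∷ e) size =
    zero , outside ∷ e , cong (inside ∷_) (sym (∪-identityˡ e)) , suc-injective size ,
    λ { (there j∈) → s≤s z≤n }
  extract-least (outside ∷ e) size with i , e′ , eq , size′ , i< ← extract-least e size =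
    suc i , outside ∷ e′ , cong (outside ∷_) eq , size′ , λ { (there j∈) → s≤s (i< j∈) }

  ∣p∣≡0⇒p≡⊥ : ∀ (p : Subset n) → ∣ p ∣ ≡ 0 → p ≡ ⊥
  ∣p∣≡0⇒p≡⊥ []            _    = refl
  ∣p∣≡0⇒p≡⊥ (outside ∷ p) size = cong (outside ∷_) (∣p∣≡0⇒p≡⊥ p size)

  -- An edge arrives as an unordered set, while chains speak of vertices in order. Extracting the
  -- least element three times supplies that order.
  increasing-triple : ∀ (e : Subset n) → ∣ e ∣ ≡ 3 →
    ∃ λ i → ∃₂ λ j k → i Fin.< j × j Fin.< k × e ≡ triple i j k
  increasing-triple e size
    with i , e₁ , refl , size₁ , i< ← extract-least e size
    with j , e₂ , refl , size₂ , j< ← extract-least e₁ size₁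
    with k , e₃ , refl , size₃ , _  ← extract-least e₂ size₂
    with refl ← ∣p∣≡0⇒p≡⊥ e₃ size₃ =
    i , j , k , i< (x∈p∪q⁺ (inj₁ (x∈⁅x⁆ j))) , j< (x∈p∪q⁺ (inj₁ (x∈⁅x⁆ k))) ,
    cong (λ p → ⁅ i ⁆ ∪ (⁅ j ⁆ ∪ p)) (∪-identityʳ ⁅ k ⁆)

  ∈-image⁻ : ∀ (f : Fin m → Fin n) p {y} → y ∈ image f p → ∃ λ x → x ∈ p × f x ≡ y
  ∈-image⁻ f p {y} y∈ with any? (λ x → (x ∈? p) ×-dec (f x ≟ᶠ y))
                         | trans (sym (lookup∘tabulate (λ y → does (any? λ x → (x ∈? p) ×-dec (f x ≟ᶠ y))) y)) ([]=⇒lookup y∈)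
  ... | yes ∃x | _ = ∃x

  ∈-image⁺ : ∀ (f : Fin m → Fin n) p {x} → x ∈ p → f x ∈ image f p
  ∈-image⁺ f p {x} x∈ = lookup⇒[]= _ _ (trans (lookup∘tabulate _ (f x))
    (dec-true (any? λ x′ → (x′ ∈? p) ×-dec (f x′ ≟ᶠ f x)) (x , x∈ , refl)))

  image-cong : ∀ {f g : Fin m → Fin n} → f ≗ g → ∀ p → image f p ≡ image g p
  image-cong f≗g p = ⊆-antisym (incl f≗g) (incl (sym ∘ f≗g))
    where
    incl : ∀ {f g} → f ≗ g → ∀ {y} → y ∈ image f p → y ∈ image g p
    incl {f} {g} f≗g y∈ with x , x∈ , refl ← ∈-image⁻ f p y∈ =
      subst (_∈ image g p) (sym (f≗g x)) (∈-image⁺ g p x∈)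

  image-triple : ∀ (f : Fin m → Fin n) x y z → image f (triple x y z) ≡ triple (f x) (f y) (f z)
  image-triple f x y z = ⊆-antisym to from
    where
    to : ∀ {w} → w ∈ image f (triple x y z) → w ∈ triple (f x) (f y) (f z)
    to w∈ with v , v∈ , refl ← ∈-image⁻ f _ w∈ with ∈-triple⁻ x y z v∈
    ... | inj₁ refl        = ∈-triple₁ (f x) (f y) (f z)
    ... | inj₂ (inj₁ refl) = ∈-triple₂ (f x) (f y) (f z)
    ... | inj₂ (inj₂ refl) = ∈-triple₃ (f x) (f y) (f z)
    from : ∀ {w} → w ∈ triple (f x) (f y) (f z) → w ∈ image f (triple x y z)
    from w∈ with ∈-triple⁻ (f x) (f y) (f z) w∈
    ... | inj₁ refl        = ∈-image⁺ f _ (∈-triple₁ x y z)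
    ... | inj₂ (inj₁ refl) = ∈-image⁺ f _ (∈-triple₂ x y z)
    ... | inj₂ (inj₂ refl) = ∈-image⁺ f _ (∈-triple₃ x y z)

  _≟ˢ_ : (p q : Subset n) → Dec (p ≡ q)
  _≟ˢ_ = ≡-dec _≟ᵇ_

  lookup-injective : ∀ {A : Set} {xs : List A} → Unique xs → ∀ {i j} → lookup xs i ≡ lookup xs j → i ≡ j
  lookup-injective (_  ∷ _) {zero}  {zero}  _  = refl
  lookup-injective (x≢ ∷ _) {zero}  {suc j} eq = ⊥-elim (All.lookup x≢ (∈-lookup j) eq)
  lookup-injective (x≢ ∷ _) {suc i} {zero}  eq = ⊥-elim (All.lookup x≢ (∈-lookup i) (sym eq))
  lookup-injective (_  ∷ u) {suc i} {suc j} eq = cong suc (lookup-injective u eq)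

  -- From an outcome of the game to a blue clique or a red tight cycle.

  module Online (χ : Colouring n) (t : ℕ) .{{_ : NonZero t}} (M : ℕ) where

    -- The game asks for a colour of every ordered triple. Degenerate triples default to blue, so
    -- red always certifies an edge and only `blue-edge` must ask for distinct vertices.
    colourIf : ∀ e → Dec (∣ e ∣ ≡ 3) → Colour
    colourIf e (yes size) = χ e size
    colourIf e (no  _)    = blue

    col : Fin n → Fin n → Fin n → Colour
    col x y z = colourIf (triple x y z) (∣ triple x y z ∣ ≟ 3)

    Edge : Colour → Subset n → Set
    Edge κ = IsEdge (monochromatic χ κ)

    red-edge : ∀ x y z → col x y z ≡ red → Edge red (triple x y z)
    red-edge x y z eq = lemma (∣ triple x y z ∣ ≟ 3) eq
      where
      lemma : ∀ size? → colourIf (triple x y z) size? ≡ red → Edge red (triple x y z)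
      lemma (yes size) eq = size , eq

    blue-edge : ∀ x y z → Distinct x y z → col x y z ≡ blue → Edge blue (triple x y z)
    blue-edge x y z dist eq = lemma (∣ triple x y z ∣ ≟ 3) eq
      where
      lemma : ∀ size? → colourIf (triple x y z) size? ≡ blue → Edge blue (triple x y z)
      lemma (yes size)  eq = size , eq
      lemma (no  ¬size) _  = ⊥-elim (¬size (∣triple∣≡3 dist))

    open OnlineGame.Game col t M public using (Pair; Chain; Path; Outcome; win)

    Chain-≢ : ∀ {W} L → Chain W L → All (λ x → All (x ≢_) W) L
    Chain-≢ []      _              = []
    Chain-≢ (y ∷ L) (y≢ , _ , chain) = y≢ ∷ All.map All.tail (Chain-≢ L chain)

    Chain-unique : ∀ {W} L → Chain W L → Unique L
    Chain-unique []      _ = []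
    Chain-unique (y ∷ L) (_ , _ , chain) =
      All.map (λ x≢ → All.head x≢ ∘ sym) (Chain-≢ L chain) ∷ Chain-unique L chain

    Path-≢ : ∀ {W d} p → Path W d p → All (d ≢_) W × All (λ x → All (x ≢_) W) p
    Path-≢ []      d≢                = d≢ , []
    Path-≢ (y ∷ p) (y≢ , _ , _ , path) with d≢ , x≢ ← Path-≢ p path =
      All.tail d≢ , y≢ ∷ All.map All.tail x≢

    Path-unique : ∀ {W d} p → Path W d p → Unique (d ∷ p)
    Path-unique []      _ = [] ∷ []
    Path-unique (y ∷ p) (_ , _ , _ , path)
      with d≢ , x≢ ← Path-≢ p path | ds ∷ us ← Path-unique p path =
      (All.head d≢ ∷ ds) ∷ All.map (λ x≢ → All.head x≢ ∘ sym) x≢ ∷ us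

    -- The head of a chain is its latest vertex, so the larger index k is the earlier vertex and
    -- comes first in the pair.
    Chain-pairs : ∀ {W} L → Chain W L → ∀ {j k} → j Fin.< k → Pair blue W (lookup L k) (lookup L j)
    Chain-pairs (y ∷ L) (_ , blues , _)  {zero}  {suc k} _         = All.lookup blues (∈-lookup k)
    Chain-pairs (y ∷ L) (_ , _ , chain) {suc j} {suc k} (s≤s j<k) = All.tail (Chain-pairs L chain j<k)

    Chain-triples : ∀ {W} L → Chain W L → ∀ {i j k} → i Fin.< j → j Fin.< k →
                    col (lookup L k) (lookup L j) (lookup L i) ≡ blue
    Chain-triples (y ∷ L) (_ , _ , chain) {zero}  {suc j} {suc k} _         (s≤s j<k) = All.head (Chain-pairs L chain j<k)
    Chain-triples (y ∷ L) (_ , _ , chain) {suc i} {suc j} {suc k} (s≤s i<j) (s≤s j<k) = Chain-triples L chain i<j j<k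

    Path-apex : ∀ {W d} p → Path W d p → ∀ j → Pair red W d (lookup p j)
    Path-apex (y ∷ p) (_ , dy , _ , _)    zero    = dy
    Path-apex (y ∷ p) (_ , _ , _ , path) (suc j) = All.tail (Path-apex p path j)

    Path-apex-triples : ∀ {W d} p → Path W d p → ∀ {i j} → i Fin.< j →
                        col d (lookup p j) (lookup p i) ≡ red
    Path-apex-triples (y ∷ p) (_ , _ , _ , path) {zero}  {suc j} _         = All.head (Path-apex p path j)
    Path-apex-triples (y ∷ p) (_ , _ , _ , path) {suc i} {suc j} (s≤s i<j) = Path-apex-triples p path i<j

    Path-consecutive : ∀ {W d} p → Path W d p → ∀ i i₁ i₂ → toℕ i₁ ≡ suc (toℕ i) → toℕ i₂ ≡ suc (suc (toℕ i)) →
                       col (lookup p i₂) (lookup p i₁) (lookup p i) ≡ red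
    Path-consecutive (y ∷ x ∷ z ∷ p) (_ , _ , _ , (_ , _ , link , _)) zero (suc zero) (suc (suc zero)) _ _ = All.head link
    Path-consecutive (y ∷ x ∷ []) _ zero _ (suc zero) _ ()
    Path-consecutive (y ∷ p) (_ , _ , _ , path) (suc i) (suc i₁) (suc i₂) eq₁ eq₂ =
      Path-consecutive p path i i₁ i₂ (suc-injective eq₁) (suc-injective eq₂)

    clique : ∀ {L} → length L ≡ t → Chain [] L → Contains (monochromatic χ blue) (Complete t)
    clique {L} refl chain = lookup L , lookup-injective (Chain-unique L chain) , edge
      where
      edge : ∀ e → ∣ e ∣ ≡ 3 → Edge blue (image (lookup L) e)
      edge e size with i , j , k , i<j , j<k , refl ← increasing-triple e size =
        subst (Edge blue) (sym (trans (image-triple (lookup L) i j k) (triple-reverse (L′ i) (L′ j) (L′ k))))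
        (blue-edge (L′ k) (L′ j) (L′ i)
          (triple-distinct′ (Finₚ.<⇒≢ i<j) (Finₚ.<⇒≢ j<k)
            (Finₚ.<⇒≢ (<-trans i<j j<k)))
          (Chain-triples L chain i<j j<k))
        where
        L′ = lookup L
        inj : ∀ {i j} → L′ i ≡ L′ j → i ≡ j
        inj = lookup-injective (Chain-unique L chain)
        triple-distinct′ : i ≢ j → j ≢ k → i ≢ k → Distinct (L′ k) (L′ j) (L′ i)
        triple-distinct′ i≢j j≢k i≢k =
          (λ eq → j≢k (sym (inj eq))) , (λ eq → i≢k (sym (inj eq))) , (λ eq → i≢j (sym (inj eq)))

    -- Position 0 of the cycle is the apex and the others run along `p`, latest vertex first. A
    -- window through 0 is red because `d` is red with any two path vertices; every other window
    -- consists of three consecutive path vertices.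
    cycle : ∀ {s d p} (4≤s : 4 ≤ s) → suc (length p) ≡ s → Path [] d p →
            Contains (monochromatic χ red) (TightCycle s 4≤s)
    cycle {s} {d} {p} 4≤s refl path = lookup (d ∷ p) , lookup-injective (Path-unique p path) , edge
      where
      f = lookup (d ∷ p)
      apex : ∀ a b → a ≢ b → Edge red (triple d (lookup p a) (lookup p b))
      apex a b a≢b with Finₚ.<-cmp a b
      ... | tri< a<b _ _ = subst (Edge red) (triple-swapʳ d _ _) (red-edge d _ _ (Path-apex-triples p path a<b))
      ... | tri≈ _ a≡b _ = ⊥-elim (a≢b a≡b)
      ... | tri> _ _ b<a = red-edge d _ _ (Path-apex-triples p path b<a)

      -- Among the numbers up to s only s itself wraps around, and it wraps to 0. A nonzero residue
      -- therefore involves no wrapping.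
      next : ∀ (i j : Fin s) k → toℕ j ≡ (toℕ i + k) % s → j ≢ zero → toℕ i + k ≤ s → toℕ j ≡ toℕ i + k
      next i j k j≡ j≢0 i+k≤s with m≤n⇒m<n∨m≡n i+k≤s
      ... | inj₁ i+k<s = trans j≡ (m<n⇒m%n≡m i+k<s)
      ... | inj₂ i+k≡s = ⊥-elim (j≢0 (toℕ-injective (trans j≡ (trans (cong (_% s) i+k≡s) (n%n≡0 s)))))

      window : ∀ (i i₁ i₂ : Fin s) → toℕ i₁ ≡ (toℕ i + 1) % s → toℕ i₂ ≡ (toℕ i + 2) % s → Distinct i i₁ i₂ →
               Edge red (triple (f i) (f i₁) (f i₂))
      window zero    zero    _       _ _ (≢ , _) = ⊥-elim (≢ refl)
      window zero    (suc _) zero    _ _ (_ , ≢ , _) = ⊥-elim (≢ refl)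
      window (suc _) zero    zero    _ _ (_ , _ , ≢) = ⊥-elim (≢ refl)
      window zero    (suc a) (suc b) _ _ (_ , _ , ≢) = apex a b (≢ ∘ cong suc)
      window (suc a) zero    (suc b) _ _ (_ , ≢ , _) =
        subst (Edge red) (triple-swap d _ _) (apex a b (≢ ∘ cong suc))
      window (suc a) (suc b) zero    _ _ (≢ , _) =
        subst (Edge red) (trans (triple-swap d _ _) (triple-swapʳ _ d _)) (apex a b (≢ ∘ cong suc))
      window (suc a) (suc b) (suc c) eq₁ eq₂ _ =
        subst (Edge red) (triple-reverse (lookup p c) _ _)
          (red-edge _ _ _ (Path-consecutive p path a b c b≡ c≡))
        where
        1+b≡ : suc (toℕ b) ≡ suc (toℕ a) + 1
        1+b≡ = next (suc a) (suc b) 1 eq₁ (λ ()) (subst (_≤ s) (+-comm 1 (suc (toℕ a))) (toℕ<n {s} (suc a)))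
        b≡ : toℕ b ≡ suc (toℕ a)
        b≡ = suc-injective (trans 1+b≡ (+-comm (suc (toℕ a)) 1))
        c≡ : toℕ c ≡ suc (suc (toℕ a))
        c≡ = suc-injective (trans
          -- The bound i + 2 ≤ s holds because i + 1 is the position `suc b`, hence below s.
          (next (suc a) (suc c) 2 eq₂ (λ ()) (subst (_≤ s) (trans (cong suc 1+b≡) (sym (+-suc (suc (toℕ a)) 1))) (toℕ<n {s} (suc b))))
          (+-comm (suc (toℕ a)) 2))

      edge : ∀ e → IsEdge (TightCycle s 4≤s) e → Edge red (image f e)
      edge e (i , refl) = subst (Edge red) (sym (image-triple f _ _ _))
        (window i _ _ (toℕ-fromℕ< _) (toℕ-fromℕ< _)
          (triple-distinct _ _ _ (size (TightCycle s 4≤s) (i , refl))))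

-- The colouring by roles: no red tight cycle and no blue clique.

module RoleColouring where

  open UniformCounting
  open Triples
  open import Data.Nat.Base using (_*_)
  open import Data.Nat.DivMod using (_%_; _mod_; _/_; m≡m%n+[m/n]*n; m%n<n; m%n%n≡m%n; %-distribˡ-+; [m+n]%n≡m%n)
  open import Data.Fin.Subset using (Subset; ∣_∣; _∪_; ⁅_⁆; _∈_)
  open import Data.Fin.Subset.Properties using (_∈?_)
  open import Data.Bool.Base using (if_then_else_)

  private variable
    n m : ℕ

  -- c x y is the role of x in the pair {x , y}.
  Consistent : (Fin n → Fin n → Fin 3) → Subset n → Set
  Consistent c e = ∀ x → x ∈ e → ∀ y → y ∈ e → x ≢ y →
    c x y ≢ c y x × (∀ z → z ∈ e → x ≢ z → c x y ≡ c x z)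

  consistent? : ∀ (c : Fin n → Fin n → Fin 3) e → Dec (Consistent c e)
  consistent? c e =
    all? λ x → (x ∈? e) →-dec (all? λ y → (y ∈? e) →-dec (¬? (x ≟ᶠ y) →-dec
      (¬? (c x y ≟ᶠ c y x) ×-dec (all? λ z → (z ∈? e) →-dec (¬? (x ≟ᶠ z) →-dec (c x y ≟ᶠ c x z))))))

  roleColouring : (Fin n → Fin n → Fin 3) → Colouring n
  roleColouring c e _ = if does (consistent? c e) then red else blue

  if-red⇒ : ∀ {P : Set} (P? : Dec P) → (if does P? then red else blue) ≡ red → P
  if-red⇒ (yes p) _ = p

  if-blue⇒¬ : ∀ {P : Set} (P? : Dec P) → (if does P? then red else blue) ≡ blue → ¬ P
  if-blue⇒¬ (no ¬p) _ = ¬p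

  red⇒consistent : ∀ (c : Fin n → Fin n → Fin 3) e → IsEdge (monochromatic (roleColouring c) red) e → Consistent c e
  red⇒consistent c e (_ , isRed) = if-red⇒ (consistent? c e) isRed

  blue⇒¬consistent : ∀ (c : Fin n → Fin n → Fin 3) e → IsEdge (monochromatic (roleColouring c) blue) e → ¬ Consistent c e
  blue⇒¬consistent c e (_ , isBlue) = if-blue⇒¬ (consistent? c e) isBlue

  Determined : Fin 3 → Fin 3 → Fin 3 → Fin 3 → Set
  Determined a b x y = x ≢ a → x ≢ b → y ≢ a → y ≢ b → a ≢ b → x ≡ y

  determined? : ∀ a b x y → Dec (Determined a b x y)
  determined? a b x y = ¬? (x ≟ᶠ a) →-dec (¬? (x ≟ᶠ b) →-dec
    (¬? (y ≟ᶠ a) →-dec (¬? (y ≟ᶠ b) →-dec (¬? (a ≟ᶠ b) →-dec (x ≟ᶠ y)))))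

  determined : ∀ a b x y → Determined a b x y
  determined = from-yes (all? λ a → all? λ b → all? λ x → all? λ y → determined? a b x y)

  module _ (c : Fin n → Fin n → Fin 3) (g : ℕ → Fin n)
           (con : ∀ k → Consistent c (triple (g k) (g (1 + k)) (g (2 + k))))
           (dist : ∀ k → Distinct (g k) (g (1 + k)) (g (2 + k))) where

    -- Only the successor enters the definition. Consistency of the overlapping windows shows, in
    -- `role-second` and `role-third`, that the same role is played towards the two preceding
    -- vertices.
    role : ℕ → Fin 3
    role k = c (g k) (g (1 + k))

    private
      x∈ : ∀ k → g k ∈ triple (g k) (g (1 + k)) (g (2 + k))
      x∈ k = ∈-triple₁ (g k) (g (1 + k)) (g (2 + k))
      y∈ : ∀ k → g (1 + k) ∈ triple (g k) (g (1 + k)) (g (2 + k))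
      y∈ k = ∈-triple₂ (g k) (g (1 + k)) (g (2 + k))
      z∈ : ∀ k → g (2 + k) ∈ triple (g k) (g (1 + k)) (g (2 + k))
      z∈ k = ∈-triple₃ (g k) (g (1 + k)) (g (2 + k))

      x≢y : ∀ k → g k ≢ g (1 + k)
      x≢y k = proj₁ (dist k)
      x≢z : ∀ k → g k ≢ g (2 + k)
      x≢z k = proj₁ (proj₂ (dist k))
      y≢z : ∀ k → g (1 + k) ≢ g (2 + k)
      y≢z k = proj₂ (proj₂ (dist k))

      role-second : ∀ k → c (g (1 + k)) (g k) ≡ role (1 + k)
      role-second k = proj₂ (con k _ (y∈ k) _ (x∈ k) (x≢y k ∘ sym)) _ (z∈ k) (y≢z k)

      role-third : ∀ k → c (g (2 + k)) (g k) ≡ role (2 + k)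
      role-third k = trans (proj₂ (con k _ (z∈ k) _ (x∈ k) (x≢z k ∘ sym)) _ (y∈ k) (y≢z k ∘ sym))
                           (role-second (1 + k))

    role-≢₁ : ∀ k → role k ≢ role (1 + k)
    role-≢₁ k eq = proj₁ (con k _ (x∈ k) _ (y∈ k) (x≢y k)) (trans eq (sym (role-second k)))

    role-≢₂ : ∀ k → role k ≢ role (2 + k)
    role-≢₂ k eq = proj₁ (con k _ (x∈ k) _ (z∈ k) (x≢z k)) (begin
      c (g k) (g (2 + k))   ≡⟨ proj₂ (con k _ (x∈ k) _ (y∈ k) (x≢y k)) _ (z∈ k) (x≢z k) ⟨
      role k                ≡⟨ eq ⟩
      role (2 + k)          ≡⟨ role-third k ⟨
      c (g (2 + k)) (g k)   ∎)
      where open ≡-Reasoning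

    -- Both values avoid the two distinct roles in between, and `Fin 3` leaves only one choice.
    role-period : ∀ k → role (3 + k) ≡ role k
    role-period k = determined (role (1 + k)) (role (2 + k)) _ _
      (role-≢₂ (1 + k) ∘ sym) (role-≢₁ (2 + k) ∘ sym) (role-≢₁ k) (role-≢₂ k) (role-≢₁ (1 + k))

    role-periods : ∀ q k → role (q * 3 + k) ≡ role k
    role-periods zero    k = refl
    role-periods (suc q) k = trans (role-period (q * 3 + k)) (role-periods q k)

    -- Roles have period 3 and also period s. A remainder 1 or 2 of s modulo 3 would make `role 1`
    -- or `role 2` equal to `role 0`, against the distinctness of three consecutive roles.
    periodic⇒3∣ : ∀ s → (∀ k → g (s + k) ≡ g k) → 3 ∣ s
    periodic⇒3∣ s g-period = go (s % 3) refl (m%n<n s 3)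
      where
      role-shift : ∀ k → role (s + k) ≡ role k
      role-shift k = cong₂ c (g-period k) (trans (cong g (sym (+-suc s k))) (g-period (1 + k)))

      s≡ : ∀ {r} → s % 3 ≡ r → ∀ k → s + k ≡ s / 3 * 3 + (r + k)
      s≡ refl k = trans (cong (_+ k) (trans (m≡m%n+[m/n]*n s 3) (+-comm (s % 3) _))) (+-assoc (s / 3 * 3) _ k)

      role-rotate : ∀ {r} → s % 3 ≡ r → ∀ k → role (r + k) ≡ role k
      role-rotate {r} eq k = begin
        role (r + k)                 ≡⟨ role-periods (s / 3) (r + k) ⟨
        role (s / 3 * 3 + (r + k))   ≡⟨ cong role (s≡ eq k) ⟨
        role (s + k)                 ≡⟨ role-shift k ⟩
        role k                       ∎
        where open ≡-Reasoning

      go : ∀ r → s % 3 ≡ r → r < 3 → 3 ∣ s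
      go 0 eq _ = divides (s / 3) (trans (m≡m%n+[m/n]*n s 3) (cong (_+ s / 3 * 3) eq))
      go 1 eq _ = ⊥-elim (role-≢₁ 0 (sym (role-rotate eq 0)))
      go 2 eq _ = ⊥-elim (role-≢₂ 0 (sym (role-rotate eq 0)))
      go (suc (suc (suc _))) _ (s≤s (s≤s (s≤s ())))

  no-red-cycle : ∀ (c : Fin n → Fin n → Fin 3) s (4≤s : 4 ≤ s) → 3 ∤ s →
                 ¬ Contains (monochromatic (roleColouring c) red) (TightCycle s 4≤s)
  no-red-cycle c s 4≤s 3∤s (f , _ , edges) = 3∤s (periodic⇒3∣ c g con dist s g-period)
    where
    instance
      s≢0 : NonZero s
      s≢0 = >-nonZero (≤-trans (s≤s z≤n) 4≤s)

    -- Unrolling the cycle along ℕ turns its windows into consecutive triples of an s-periodic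
    -- sequence.
    g : ℕ → _
    g k = f (k mod s)

    toℕ-mod : ∀ k → toℕ (k mod s) ≡ k % s
    toℕ-mod k = toℕ-fromℕ< (m%n<n k s)

    mod-cong : ∀ {j k} → j % s ≡ k % s → j mod s ≡ k mod s
    mod-cong {j} {k} eq = toℕ-injective (trans (toℕ-mod j) (trans eq (sym (toℕ-mod k))))

    g-period : ∀ k → g (s + k) ≡ g k
    g-period k = cong f (mod-cong (trans (cong (_% s) (+-comm s k)) ([m+n]%n≡m%n k s)))

    shift : ∀ k d → (toℕ (k mod s) + d) mod s ≡ (d + k) mod s
    shift k d = mod-cong (begin
      (toℕ (k mod s) + d) % s       ≡⟨ cong (λ j → (j + d) % s) (toℕ-mod k) ⟩
      (k % s + d) % s               ≡⟨ %-distribˡ-+ (k % s) d s ⟩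
      (k % s % s + d % s) % s       ≡⟨ cong (λ j → (j + d % s) % s) (m%n%n≡m%n k s) ⟩
      (k % s + d % s) % s           ≡⟨ %-distribˡ-+ k d s ⟨
      (k + d) % s                   ≡⟨ cong (_% s) (+-comm k d) ⟩
      (d + k) % s                   ∎)
      where open ≡-Reasoning

    window-edge : ∀ k → IsEdge (monochromatic (roleColouring c) red) (triple (g k) (g (1 + k)) (g (2 + k)))
    window-edge k = subst (IsEdge (monochromatic (roleColouring c) red)) (begin
      image f (consecutive s (k mod s))
        ≡⟨ image-triple f (k mod s) _ _ ⟩
      triple (g k) (f ((toℕ (k mod s) + 1) mod s)) (f ((toℕ (k mod s) + 2) mod s))
        ≡⟨ cong₂ (λ i j → triple (g k) (f i) (f j)) (shift k 1) (shift k 2) ⟩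
      triple (g k) (g (1 + k)) (g (2 + k)) ∎) (edges _ (k mod s , refl))
      where open ≡-Reasoning

    con : ∀ k → Consistent c (triple (g k) (g (1 + k)) (g (2 + k)))
    con k = red⇒consistent c _ (window-edge k)

    dist : ∀ k → Distinct (g k) (g (1 + k)) (g (2 + k))
    dist k = triple-distinct _ _ _ (proj₁ (window-edge k))

  ∈-triple-index : ∀ (v : Fin 3 → Fin n) {w} → w ∈ triple (v zero) (v (suc zero)) (v (suc (suc zero))) →
                   ∃ λ r → w ≡ v r
  ∈-triple-index v w∈ with ∈-triple⁻ (v zero) (v (suc zero)) (v (suc (suc zero))) w∈
  ... | inj₁ eq        = _ , eq
  ... | inj₂ (inj₁ eq) = _ , eq
  ... | inj₂ (inj₂ eq) = _ , eq

  matches⇒consistent : ∀ (c : Fin n → Fin n → Fin 3) {v : Fin 3 → Fin n} → Injective _≡_ _≡_ v → Matches c v →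
                       Consistent c (triple (v zero) (v (suc zero)) (v (suc (suc zero))))
  matches⇒consistent c {v} inj matches x x∈ y y∈ x≢y
    with r , refl ← ∈-triple-index v x∈ | r′ , refl ← ∈-triple-index v y∈ =
    (λ eq → x≢y (cong v (begin
      r               ≡⟨ matches r r′ (x≢y ∘ cong v) ⟨
      c (v r) (v r′)  ≡⟨ eq ⟩
      c (v r′) (v r)  ≡⟨ matches r′ r (x≢y ∘ cong v ∘ sym) ⟩
      r′              ∎))) ,
    λ z z∈ x≢z → same (∈-triple-index v z∈) x≢z
    where
    open ≡-Reasoning
    same : ∀ {z} → (∃ λ r″ → z ≡ v r″) → v r ≢ z → c (v r) (v r′) ≡ c (v r) z
    same (r″ , refl) x≢z = trans (matches r r′ (x≢y ∘ cong v)) (sym (matches r r″ (x≢z ∘ cong v)))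

  no-blue-clique : ∀ (c : Fin n → Fin n → Fin 3) {T t} → T ≤ t →
    (∀ (f : Fin T → Fin n) → Injective _≡_ _≡_ f →
     ∃ λ (v : Fin 3 → Fin n) → (∀ r → ∃ λ i → v r ≡ f i) × Injective _≡_ _≡_ v × Matches c v) →
    ¬ Contains (monochromatic (roleColouring c) blue) (Complete t)
  no-blue-clique {n} c {T} {t} T≤t labelled (f , f-inj , edges) =
    refute (labelled (λ i → f (inject≤ i T≤t)) (λ eq → inject≤-injective T≤t T≤t _ _ (f-inj eq)))
    where
    refute : ¬ (∃ λ (v : Fin 3 → Fin n) → (∀ r → ∃ λ i → v r ≡ f (inject≤ i T≤t)) × Injective _≡_ _≡_ v × Matches c v)
    refute (v , v∈f , v-inj , matches) = blue⇒¬consistent c _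
      (subst (IsEdge (monochromatic (roleColouring c) blue)) image≡ (edges _ (∣triple∣≡3 u-distinct)))
      (matches⇒consistent c v-inj matches)
      where
      u : Fin 3 → Fin t
      u r = inject≤ (proj₁ (v∈f r)) T≤t
      image≡ : image f (triple (u zero) (u (suc zero)) (u (suc (suc zero)))) ≡
               triple (v zero) (v (suc zero)) (v (suc (suc zero)))
      image≡ = trans (image-triple f _ _ _)
        (sym (cong₂ _∪_ (cong ⁅_⁆ (proj₂ (v∈f zero)))
          (cong₂ _∪_ (cong ⁅_⁆ (proj₂ (v∈f (suc zero)))) (cong ⁅_⁆ (proj₂ (v∈f (suc (suc zero))))))))
      u-injective : ∀ r r′ → r ≢ r′ → u r ≢ u r′
      u-injective r r′ r≢r′ eq = r≢r′ (v-inj (trans (proj₂ (v∈f r)) (trans (cong f eq) (sym (proj₂ (v∈f r′))))))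
      u-distinct : Distinct (u zero) (u (suc zero)) (u (suc (suc zero)))
      u-distinct = u-injective _ _ (λ ()) , u-injective _ _ (λ ()) , u-injective _ _ (λ ())

  ¬arrows : ∀ n m {s t} (4≤s : 4 ≤ s) → 3 ∤ s → 3 * (m + m) ≤ t →
            n ^ (3 * (m + m)) * 728 ^ (m * m) < 729 ^ (m * m) → ¬ Arrows n (TightCycle s 4≤s) (Complete t)
  ¬arrows n m {s} {t} 4≤s 3∤s 6m≤t bound arrows = refute (exists-labelling n m bound)
    where
    refute : _ → _
    refute (c , labelled) with arrows (roleColouring c)
    ... | inj₁ cycle  = no-red-cycle c s 4≤s 3∤s cycle
    ... | inj₂ clique = no-blue-clique c 6m≤t labelled clique

-- Decidability of arrowing, which yields a least order.

module Decidability where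

  open UniformCounting using (injective?)
  open Triples
  open import Data.Nat.Induction using (<-rec)
  open import Data.Fin.Properties using (any?)
  open import Data.Fin.Subset using (Subset; ∣_∣)
  open import Data.Fin.Subset.Properties using (anySubset?)
  open import Data.Bool.Base using (if_then_else_)
  open import Data.Vec.Base using (tabulate)
  import Data.Vec.Base as Vec
  open import Data.Vec.Properties using (lookup∘tabulate; tabulate∘lookup; tabulate-cong)
  open import Function.Bundles using (Inverse)

  private variable
    n m : ℕ

  allSubset? : ∀ {P : Subset n → Set} → (∀ p → Dec (P p)) → Dec (∀ p → P p)
  allSubset? P? with anySubset? (¬? ∘ P?)
  ... | yes (p , ¬Pp) = no λ all → ¬Pp (all p)
  ... | no  ¬∃        = yes λ p → decidable-stable (P? p) λ ¬Pp → ¬∃ (p , ¬Pp)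

  -- The search runs over codes; invariance of `P` under pointwise equality takes the place of
  -- function extensionality.
  anyFun? : ∀ {P : (Fin m → Fin n) → Set} → (∀ {f g} → f ≗ g → P f → P g) → (∀ f → Dec (P f)) → Dec (∃ P)
  anyFun? P-resp P? = map′ (λ (k , Pk) → finToFun k , Pk)
    (λ (f , Pf) → funToFin f , P-resp (sym ∘ finToFun-funToFin f) Pf) (any? (P? ∘ finToFun))

  DecidableEdges : ThreeGraph → Set
  DecidableEdges H = ∀ e → Dec (IsEdge H e)

  contains? : ∀ H F → DecidableEdges H → DecidableEdges F → Dec (Contains H F)
  contains? H F H? F? = anyFun? transport λ f →
    injective? f ×-dec allSubset? λ e → F? e →-dec H? (image f e)
    where
    transport : ∀ {f g} → f ≗ g → Injective _≡_ _≡_ f × (∀ e → IsEdge F e → IsEdge H (image f e)) →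
           Injective _≡_ _≡_ g × (∀ e → IsEdge F e → IsEdge H (image g e))
    transport f≗g (inj , edges) = (λ eq → inj (trans (f≗g _) (trans eq (sym (f≗g _))))) ,
      λ e e∈F → subst (IsEdge H) (image-cong f≗g e) (edges e e∈F)

  _≟ᶜ_ : (κ κ′ : Colour) → Dec (κ ≡ κ′)
  red  ≟ᶜ red  = yes refl
  red  ≟ᶜ blue = no λ ()
  blue ≟ᶜ red  = no λ ()
  blue ≟ᶜ blue = yes refl

  monochromatic? : ∀ (χ : Colouring n) κ → DecidableEdges (monochromatic χ κ)
  monochromatic? χ κ e with ∣ e ∣ ≟ 3
  ... | no  ¬size = no (¬size ∘ proj₁)
  ... | yes size with χ e size ≟ᶜ κ
  ... | yes eq = yes (size , eq)
  ... | no ¬eq = no λ (size′ , eq) → ¬eq (trans (cong (χ e) (≡-irrelevant size size′)) eq)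

  complete? : ∀ t → DecidableEdges (Complete t)
  complete? t e = ∣ e ∣ ≟ 3

  tightCycle? : ∀ s 4≤s → DecidableEdges (TightCycle s 4≤s)
  tightCycle? s 4≤s e = any? λ i → e ≟ˢ _

  encode : Subset n → Fin (2 ^ n)
  encode e = funToFin λ i → Inverse.from 2↔Bool (Vec.lookup e i)

  decode : Fin (2 ^ n) → Subset n
  decode k = tabulate λ i → Inverse.to 2↔Bool (finToFun k i)

  decode-encode : ∀ (e : Subset n) → decode (encode e) ≡ e
  decode-encode e = trans (tabulate-cong λ i → trans
    (cong (Inverse.to 2↔Bool) (finToFun-funToFin _ i)) (Inverse.strictlyInverseˡ 2↔Bool (Vec.lookup e i)))
    (tabulate∘lookup e)

  -- A code is the set of codes of the red sets. Colourings become subsets of a finite set, so a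
  -- statement about all colourings can be decided by exhaustion.
  fromCode : Subset (2 ^ n) → Colouring n
  fromCode C e _ = if Vec.lookup C (encode e) then red else blue

  toCode : Colouring n → Subset (2 ^ n)
  toCode χ = tabulate λ k → does (monochromatic? χ red (decode k))

  fromCode-toCode : ∀ (χ : Colouring n) e size → fromCode (toCode χ) e size ≡ χ e size
  fromCode-toCode χ e size = trans
    (cong (λ b → if b then red else blue)
      (trans (lookup∘tabulate (λ k → does (monochromatic? χ red (decode k))) (encode e))
             (cong (λ e → does (monochromatic? χ red e)) (decode-encode e))))
    (lemma (monochromatic? χ red e))
    where
    lemma : (red? : Dec (IsEdge (monochromatic χ red) e)) → (if does red? then red else blue) ≡ χ e size
    lemma (yes (size′ , eq)) = trans (sym eq) (cong (χ e) (≡-irrelevant size′ size))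
    lemma (no  ¬red) with χ e size in eq
    ... | red  = ⊥-elim (¬red (size , eq))
    ... | blue = refl

  Contains-resp : ∀ {χ χ′ : Colouring n} {κ F} → (∀ e size → χ e size ≡ χ′ e size) →
    Contains (monochromatic χ κ) F → Contains (monochromatic χ′ κ) F
  Contains-resp χ≡ (f , inj , edges) = f , inj , λ e e∈F →
    let size , eq = edges e e∈F in size , trans (sym (χ≡ _ size)) eq

  arrows? : ∀ F G → DecidableEdges F → DecidableEdges G → ∀ n → Dec (Arrows n F G)
  arrows? F G F? G? n = map′
    (λ all χ → Sum.map (Contains-resp {χ = fromCode (toCode χ)} {χ} {red} {F = F} (fromCode-toCode χ))
                       (Contains-resp {χ = fromCode (toCode χ)} {χ} {blue} {F = G} (fromCode-toCode χ))
                       (all (toCode χ)))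
    (λ arrows C → arrows (fromCode C))
    (allSubset? λ C → contains? (monochromatic (fromCode C) red) F (monochromatic? (fromCode C) red) F? ⊎-dec
                      contains? (monochromatic (fromCode C) blue) G (monochromatic? (fromCode C) blue) G?)

  Least : (ℕ → Set) → Set
  Least P = ∃ λ r → P r × (∀ m → P m → r ≤ m)

  -- The Ramsey number has to be exhibited as a minimum. Strong induction descends from `N` as long
  -- as a smaller witness is found.
  least : ∀ {P : ℕ → Set} → (∀ n → Dec (P n)) → ∀ N → P N → Least P
  least {P} P? = <-rec (λ N → P N → Least P) λ N rec PN → step N rec PN (anyUpTo? P? N)
    where
    step : ∀ N → (∀ {m} → m < N → P m → Least P) → P N → Dec (∃ λ m → m < N × P m) → Least P
    step N rec PN (yes (m , m<N , Pm)) = rec m<N Pm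
    step N rec PN (no ¬∃) = N , PN , λ m Pm → ≮⇒≥ λ m<N → ¬∃ (m , m<N , Pm)

-- Numerical estimates for the two bounds.

module Estimates where

  open Triples
  open RoleColouring
  open import Data.Nat.Base using (_*_)
  open import Data.Nat.DivMod using (_/_; _%_; m/n*n≤m; m%n<n; m≡m%n+[m/n]*n; m≥n⇒m/n>0)

  -- Bernoulli's inequality (1 + 1/q)^k ≥ 1 + k/q, multiplied by q^(k + 1).
  bernoulli : ∀ q k → (q + k) * q ^ k ≤ q * suc q ^ k
  bernoulli q zero    = ≤-reflexive (cong (_* 1) (+-identityʳ q))
  bernoulli q (suc k) = begin
    (q + suc k) * (q * q ^ k)      ≡⟨ *-assoc (q + suc k) q (q ^ k) ⟨
    (q + suc k) * q * q ^ k        ≤⟨ *-monoˡ-≤ (q ^ k) (m≤m+n ((q + suc k) * q) k) ⟩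
    ((q + suc k) * q + k) * q ^ k  ≡⟨ expand q k (q ^ k) ⟩
    suc q * ((q + k) * q ^ k)      ≤⟨ *-monoʳ-≤ (suc q) (bernoulli q k) ⟩
    suc q * (q * suc q ^ k)        ≡⟨ swap (suc q) q (suc q ^ k) ⟩
    q * (suc q * suc q ^ k)        ∎
    where
    open ≤-Reasoning
    expand : ∀ q k x → ((q + suc k) * q + k) * x ≡ suc q * ((q + k) * x)
    expand = solve-∀
    swap : ∀ a b c → a * (b * c) ≡ b * (a * c)
    swap = solve-∀

  2*q^q≤[1+q]^q : ∀ q .{{_ : NonZero q}} → 2 * q ^ q ≤ suc q ^ q
  2*q^q≤[1+q]^q q = *-cancelˡ-≤ q (begin
    q * (2 * q ^ q)  ≡⟨ double q (q ^ q) ⟩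
    (q + q) * q ^ q  ≤⟨ bernoulli q q ⟩
    q * suc q ^ q    ∎)
    where
    open ≤-Reasoning
    double : ∀ q x → q * (2 * x) ≡ (q + q) * x
    double = solve-∀

  ^-distribʳ-* : ∀ e m n → (m * n) ^ e ≡ m ^ e * n ^ e
  ^-distribʳ-* zero    m n = refl
  ^-distribʳ-* (suc e) m n = trans (cong (m * n *_) (^-distribʳ-* e m n)) ([m*n]*[o*p]≡[m*o]*[n*p] m n (m ^ e) (n ^ e))

  -- With m = q(6k + 1), the exponent m² is q times e = (6k + 1)m, so (1 + 1/q)^q ≥ 2 gives (1 +
  -- 1/q)^(m²) ≥ 2^e, while n^(6m) ≤ 2^(6km). The 1 in 6k + 1 leaves a factor 2^m and makes the
  -- inequality strict.
  union-bound : ∀ q .{{_ : NonZero q}} k n → n ≤ 2 ^ k → let m = q * suc (6 * k) in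
                n ^ (3 * (m + m)) * q ^ (m * m) < suc q ^ (m * m)
  union-bound q k n n≤2^k = begin-strict
    n ^ (3 * (m + m)) * q ^ (m * m)
      ≤⟨ *-monoˡ-≤ (q ^ (m * m)) (^-monoˡ-≤ (3 * (m + m)) n≤2^k) ⟩
    (2 ^ k) ^ (3 * (m + m)) * q ^ (m * m)
      <⟨ *-monoˡ-< (q ^ (m * m)) {{m^n≢0 q (m * m)}} exponents ⟩
    2 ^ e * q ^ (m * m)
      ≡⟨ cong (λ i → 2 ^ e * q ^ i) m*m≡q*e ⟩
    2 ^ e * q ^ (q * e)
      ≡⟨ cong (2 ^ e *_) (^-*-assoc q q e) ⟨
    2 ^ e * (q ^ q) ^ e
      ≡⟨ ^-distribʳ-* e 2 (q ^ q) ⟨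
    (2 * q ^ q) ^ e
      ≤⟨ ^-monoˡ-≤ e (2*q^q≤[1+q]^q q) ⟩
    (suc q ^ q) ^ e
      ≡⟨ ^-*-assoc (suc q) q e ⟩
    suc q ^ (q * e)
      ≡⟨ cong (suc q ^_) m*m≡q*e ⟨
    suc q ^ (m * m) ∎
    where
    open ≤-Reasoning
    m e : ℕ
    m = q * suc (6 * k)
    e = suc (6 * k) * m
    m*m≡q*e : m * m ≡ q * e
    m*m≡q*e = *-assoc q (suc (6 * k)) m
    exponents : (2 ^ k) ^ (3 * (m + m)) < 2 ^ e
    exponents = begin-strict
      (2 ^ k) ^ (3 * (m + m))  ≡⟨ ^-*-assoc 2 k (3 * (m + m)) ⟩
      2 ^ (k * (3 * (m + m)))  <⟨ ^-monoʳ-< 2 ≤-refl (begin-strict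
        k * (3 * (m + m))      ≡⟨ six k m ⟩
        6 * k * m              <⟨ m<n+m (6 * k * m) (>-nonZero⁻¹ m {{m*n≢0 q (suc (6 * k))}}) ⟩
        e                      ∎) ⟩
      2 ^ e                    ∎
      where
      six : ∀ k m → k * (3 * (m + m)) ≡ 6 * k * m
      six = solve-∀

  -- With m = q (6k + 1) as in union-bound, the first bound reads 6m ≤ t.
  floor-bounds : ∀ q .{{_ : NonZero q}} t → 42 * q ≤ t → ∃ λ k →
                 3 * (q * suc (6 * k) + q * suc (6 * k)) ≤ t × t ≤ k * suc (pred (84 * q))
  floor-bounds q t D≤t = k , (begin
      3 * (q * suc (6 * k) + q * suc (6 * k))  ≡⟨ expand q k ⟩
      36 * (q * k) + 6 * q * 1                 ≤⟨ +-monoʳ-≤ (36 * (q * k)) (*-monoʳ-≤ (6 * q) 1≤k) ⟩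
      36 * (q * k) + 6 * q * k                 ≡⟨ collect q k ⟩
      k * D                                    ≤⟨ m/n*n≤m t D ⟩
      t                                        ∎) ,
    (begin
      t                        ≡⟨ m≡m%n+[m/n]*n t D ⟩
      t % D + k * D            ≤⟨ +-monoˡ-≤ (k * D) (<⇒≤ (m%n<n t D)) ⟩
      D + k * D                ≡⟨ cong (_+ k * D) (*-identityˡ D) ⟨
      1 * D + k * D            ≤⟨ +-monoˡ-≤ (k * D) (*-monoˡ-≤ D 1≤k) ⟩
      k * D + k * D            ≡⟨ double q k ⟩
      k * (84 * q)             ≡⟨ cong (k *_) (suc-pred (84 * q) {{m*n≢0 84 q}}) ⟨
      k * suc (pred (84 * q))  ∎)
    where
    open ≤-Reasoning
    -- For k ≥ 1 the number 6m = 36qk + 6q is at most 42qk, whence 42. Then t < (k + 1)D ≤ 2kD gives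
    -- 84.
    D : ℕ
    D = 42 * q
    instance
      D≢0 : NonZero D
      D≢0 = m*n≢0 42 q
    k : ℕ
    k = t / D
    1≤k : 1 ≤ k
    1≤k = m≥n⇒m/n>0 D≤t
    expand : ∀ q k → 3 * (q * suc (6 * k) + q * suc (6 * k)) ≡ 36 * (q * k) + 6 * q * 1
    expand = solve-∀
    collect : ∀ q k → 36 * (q * k) + 6 * q * k ≡ k * (42 * q)
    collect = solve-∀
    double : ∀ q k → k * (42 * q) + k * (42 * q) ≡ k * (84 * q)
    double = solve-∀

  -- This is r > 2^(t/(d + 1)) with d + 1 = 84 · 728. If r ≤ 2^k for the k of `floor-bounds`, the
  -- union bound with q = 728 refutes arrowing.
  lower-bound : ∃₂ λ d T → ∀ {s} (4≤s : 4 ≤ s) → 3 ∤ s → ∀ t → t ≥ T → ∀ r →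
                Arrows r (TightCycle s 4≤s) (Complete t) → 2 ^ t < r ^ suc d
  lower-bound = pred (84 * 728) , 42 * 728 , λ 4≤s 3∤s t t≥T r arrows →
    bound 4≤s 3∤s (pred (84 * 728)) r arrows (floor-bounds 728 t t≥T)
    where
    open ≤-Reasoning
    bound : ∀ {s t} (4≤s : 4 ≤ s) → 3 ∤ s → ∀ d r → Arrows r (TightCycle s 4≤s) (Complete t) →
      (∃ λ k → 3 * (728 * suc (6 * k) + 728 * suc (6 * k)) ≤ t × t ≤ k * suc d) → 2 ^ t < r ^ suc d
    bound {s} {t} 4≤s 3∤s d r arrows (k , 6m≤t , t≤kd) = begin-strict
      2 ^ t            ≤⟨ ^-monoʳ-≤ 2 t≤kd ⟩
      2 ^ (k * suc d)  ≡⟨ ^-*-assoc 2 k (suc d) ⟨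
      (2 ^ k) ^ suc d  <⟨ ^-monoˡ-< (suc d) 2^k<r ⟩
      r ^ suc d        ∎
      where
      2^k<r : 2 ^ k < r
      2^k<r = ≰⇒> λ r≤2^k → ¬arrows r (728 * suc (6 * k)) 4≤s 3∤s 6m≤t (union-bound 728 k r r≤2^k) arrows

  -- This is `stepCost ^ suc capacity` of the game, written without reference to a colouring.
  order-bound : ℕ → ℕ → ℕ
  order-bound M t = suc (t ^ suc M) ^ suc (t * suc (M * t))

  arrows-order-bound : ∀ {s} (4≤s : 4 ≤ s) t .{{_ : NonZero t}} →
                       Arrows (order-bound (s ∸ 2) t) (TightCycle s 4≤s) (Complete t)
  arrows-order-bound {s} 4≤s t χ = conclude (win (allFin N) (allFin⁺ N) (≤-reflexive (sym (length-tabulate {n = N} id))))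
    where
    N = order-bound (s ∸ 2) t
    open Online χ t (s ∸ 2)
    conclude : Outcome → _
    conclude (inj₁ (L , len , chain))    = inj₂ (clique len chain)
    conclude (inj₂ (d , p , len , path)) =
      inj₁ (cycle 4≤s (trans (cong suc len) (m+[n∸m]≡n (≤-trans (s≤s (s≤s z≤n)) 4≤s))) path)

  -- Put s = 2 + M. A step costs t^(s - 1) + 1 ≤ t^s and there are at most s t² steps, so t^(s² t²)
  -- suffices; one more t² in the exponent makes the inequality strict.
  order-bound< : ∀ M t → 2 ≤ t → order-bound M t < t ^ (suc ((2 + M) * (2 + M)) * t ^ 2)
  order-bound< M t 2≤t = begin-strict
    suc (t ^ suc M) ^ suc (t * suc (M * t))  ≤⟨ ^-monoˡ-≤ (suc (t * suc (M * t))) step≤ ⟩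
    (t ^ (2 + M)) ^ suc (t * suc (M * t))    ≤⟨ ^-monoʳ-≤ (t ^ (2 + M)) {{m^n≢0 t (2 + M)}} steps≤ ⟩
    (t ^ (2 + M)) ^ ((2 + M) * t ^ 2)        ≡⟨ ^-*-assoc t (2 + M) ((2 + M) * t ^ 2) ⟩
    t ^ ((2 + M) * ((2 + M) * t ^ 2))        ≡⟨ cong (t ^_) (*-assoc (2 + M) (2 + M) (t ^ 2)) ⟨
    t ^ ((2 + M) * (2 + M) * t ^ 2)          <⟨ ^-monoʳ-< t 2≤t (m<n+m _ (m^n>0 t 2)) ⟩
    t ^ (suc ((2 + M) * (2 + M)) * t ^ 2)    ∎
    where
    open ≤-Reasoning
    instance
      t≢0 : NonZero t
      t≢0 = >-nonZero (≤-trans (s≤s z≤n) 2≤t)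
    step≤ : suc (t ^ suc M) ≤ t ^ (2 + M)
    step≤ = begin
      1 + t ^ suc M          ≤⟨ +-monoˡ-≤ (t ^ suc M) (m^n>0 t (suc M)) ⟩
      t ^ suc M + t ^ suc M  ≡⟨ cong (λ x → t ^ suc M + x) (+-identityʳ _) ⟨
      2 * t ^ suc M          ≤⟨ *-monoˡ-≤ (t ^ suc M) 2≤t ⟩
      t ^ (2 + M)            ∎
    steps≤ : suc (t * suc (M * t)) ≤ (2 + M) * t ^ 2
    steps≤ = begin
      1 + t * suc (M * t)    ≡⟨ cong suc (*-suc t (M * t)) ⟩
      1 + (t + t * (M * t))  ≤⟨ +-mono-≤ (m^n>0 t 2) (+-monoˡ-≤ _ (m≤m*n t (t * 1) {{m*n≢0 t 1}})) ⟩
      t ^ 2 + (t ^ 2 + t * (M * t)) ≡⟨ collect M t ⟩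
      (2 + M) * t ^ 2              ∎
      where
      collect : ∀ M t → t * (t * 1) + (t * (t * 1) + t * (M * t)) ≡ (2 + M) * (t * (t * 1))
      collect = solve-∀

-- Assembling the two bounds.

open Decidability
open Estimates
open import Data.Nat.Base using (ℕ; _≤_; _≥_; _^_) renaming (_*_ to _*ₙ_)
open import Data.Nat.Properties using (<⇒≤)
open import Data.Nat.Divisibility using (_∤_)
open import Data.Integer.Base using (+_)
open import Data.Integer.Properties using (pos-*)
open import Data.Rational.Unnormalised.Base using (ℚᵘ; mkℚᵘ; Positive; _*_; _/_)
open import Data.Product.Base using (Σ; ∃; _×_)

-- Comparison with a rational power computes on a literal `mkℚᵘ (+ p) d`, so the product of a
-- constant with t or t² is brought to that form.
mkℚᵘ-* : ∀ p d t → mkℚᵘ (+ p) d * (+ t / 1) ≡ mkℚᵘ (+ (p *ₙ t)) d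
mkℚᵘ-* p d t = cong₂ mkℚᵘ (sym (pos-* p t)) (*-identityʳ d)

theorem1p1 : ∀ (s : ℕ) (5≤s : 5 ≤ s) → 3 ∤ s →
    Σ ℚᵘ λ a → Σ ℚᵘ λ b → Positive a × Positive b ×
    ∃ λ (T : ℕ) → ∀ (t : ℕ) → t ≥ T →
    ∃ λ (r : ℕ) → IsRamseyNumber (TightCycle s (<⇒≤ 5≤s)) (Complete t) r ×
    (2 ^[ a * (+ t / 1) ]< r) ×
    (r <2^[ b * (+ (t ^ 2) / 1) ·log₂ t ])
theorem1p1 s 5≤s 3∤s = assemble lower-bound
  where
  4≤s = <⇒≤ 5≤s
  -- This is s² + 1, because 2 + (s ∸ 2) is s.
  β = suc ((2 + (s ∸ 2)) *ₙ (2 + (s ∸ 2)))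

  ramsey : ∀ t .{{_ : NonZero t}} →
           ∃ λ r → IsRamseyNumber (TightCycle s 4≤s) (Complete t) r × r ≤ order-bound (s ∸ 2) t
  ramsey t with r , arrows , minimal ← least (arrows? (TightCycle s 4≤s) (Complete t) (tightCycle? s 4≤s) (complete? t))
                                              (order-bound (s ∸ 2) t) (arrows-order-bound 4≤s t) =
    r , (arrows , minimal) , minimal _ (arrows-order-bound 4≤s t)

  assemble : (∃₂ λ d T → ∀ {s} (4≤s : 4 ≤ s) → 3 ∤ s → ∀ t → t ≥ T → ∀ r →
              Arrows r (TightCycle s 4≤s) (Complete t) → 2 ^ t < r ^ suc d) → _
  -- Here a = 1/(d + 1) and b = β. Adding 2 to the threshold ensures t ≥ 2 for the upper estimate.
  assemble (d , T , lower) = mkℚᵘ (+ 1) d , mkℚᵘ (+ β) 0 , _ , _ , 2 + T , λ t t≥ →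
    let 2≤t = ≤-trans (m≤m+n 2 T) t≥
        r , isRamsey , r≤ = ramsey t {{>-nonZero (<⇒≤ 2≤t)}}
    in r , isRamsey ,
       subst (2 ^[_]< r) (sym (mkℚᵘ-* 1 d t))
         (subst (λ i → 2 ^ i < r ^ suc d) (sym (*-identityˡ t))
           (lower 4≤s 3∤s t (≤-trans (m≤n+m T 2) t≥) r (proj₁ isRamsey))) ,
       subst (r < t ^[_]) (sym (mkℚᵘ-* β 0 (t ^ 2)))
         (subst (_< t ^ (β *ₙ t ^ 2)) (sym (*-identityʳ r)) (≤-<-trans r≤ (order-bound< (s ∸ 2) t 2≤t)))
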